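{- Let $P$ be any linear relaxation of the CFL (metric capacitated facility location) polytope for the family of instances $I(3n,n^4+1,U,1)$ that uses the classic variables $(y,x)$ and has size $2^{o(n)}$. There is a constant $c>0$ such that for all $t\le cn$ the integrality gap of $\operatorname{SA}^t(P)$ is $\Omega(n)$.
   Context: Instances. $I(3n,n^4+1,U,1)$ has a set $F$ of $3n$ facilities, a set $C$ of $m=n^4+1$ clients of unit demand, and uniform capacity $U$ with $(n^4+1)-nU=2^{ -n^2}$. The classic variables are $y_i$ ($i\in F$, facility opening, integer) and $x_{ij}$ ($i\in F,j\in C$, fraction of demand of $j$ assigned to $i$, fractional). The mixed integer feasible solutions are $(y,x)\in\{0,1\}^{3n}\times[0,1]^{3nm}$ with $\sum_i x_{ij}=1$ for all $j$, $0\le x_{ij}\le y_i$, and $\sum_j x_{ij}\le Uy_i$; the CFL polytope is their convex hull. Admissible objectives (to minimize) are $\sum_i f_iy_i+\sum_{i,j}c_{ij}x_{ij}$ with $f_i,c_{ij}\ge0$ and $c_{ij}\le c_{i'j}+c_{i'j'}+c_{ij'}$ for all $i,i',j,j'$. A linear relaxation (for the family) is, for each $n$, a polyhedron $P$ in the space of the variables $(y,x)$ that contains the CFL polytope and, as required for the Sherali-Adams procedure, has the same points with $y\in\{0,1\}^{3n}$, $x\in[0,1]^{3nm}$ as the CFL polytope. Its size is the minimum number of inequalities in a halfspace description. Its integrality gap is the supremum, over admissible objectives, of the ratio of the optimal mixed integer cost to the optimal cost over the relaxation. Sherali-Adams at level $t\ge1$: for every linear constraint $\pi(y,x)\le0$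 in the description of $P$, every set $A\subseteq\{y_i\mid i\in F\}$ with $|A|\le t$, and every $W\subseteq A$, consider the lifted constraint $\pi(y,x)\prod_{y_i\in A-W}y_i\prod_{y_i\in W}(1-y_i)\le0$. Linearize by replacing each $y_i^2$ by $y_i$, each product $\prod_{i\in S}y_i$ by a new variable $y_S$, and each product $x_{ij}\prod_{i'\in S}y_{i'}$ by a new variable $v_{S,ij}$. $\operatorname{SA}^t(P)$ is the projection of the resulting linear system onto the original variables $(y,x)$. -}

module Defs where

open import Level using (0ℓ) renaming (suc to lsuc)
open import Algebra.Bundles using (CommutativeRing; Semiring)
import Algebra.Definitions.RawSemiring as RawSemiringDefs
open import Data.Bool using (if_then_else_)
open import Data.Fin using (Fin)
open import Data.Fin.Subset using (Subset; ⁅_⁆; _∪_; _⊆_; ∣_∣) renaming (⊥ to ∅)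
open import Data.Fin.Subset.Properties using (_∈?_)
open import Data.List using (List; []; _∷_; _++_; map; foldr; allFin; cartesianProduct; length)
open import Data.List.Relation.Unary.All using (All)
open import Data.Nat as ℕ using (ℕ)
open import Data.Product using (Σ; ∃; ∃-syntax; _×_; _,_)
open import Data.Sum using (_⊎_)
open import Data.Vec.Functional using (Vector)
open import Function using (_⇔_)
open import Relation.Binary using (Rel; IsDecTotalOrder)
open import Relation.Binary.PropositionalEquality using (_≡_)
open import Relation.Nullary using (¬_; does)
open import Relation.Unary using (Pred)

-- The real numbers, axiomatised (classically) as a Dedekind-complete ordered
-- field; these axioms determine ℝ up to isomorphism.  The value of 0# ⁻¹ is
-- unspecified.
record RealNumbers : Set (lsuc 0ℓ) where
  field
    commutativeRing : CommutativeRing 0ℓ 0ℓ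
  open CommutativeRing commutativeRing public
  infix 4 _≤_
  infix 9 _⁻¹
  field
    _≤_             : Rel Carrier 0ℓ
    isDecTotalOrder : IsDecTotalOrder _≈_ _≤_
    +-monoʳ-≤       : ∀ x {y z} → y ≤ z → x + y ≤ x + z
    *-nonNeg        : ∀ {x y} → 0# ≤ x → 0# ≤ y → 0# ≤ x * y
    0≉1             : ¬ (0# ≈ 1#)
    _⁻¹             : Carrier → Carrier
    ⁻¹-inverseʳ     : ∀ x → ¬ (x ≈ 0#) → x * x ⁻¹ ≈ 1#
    complete        : (S : Pred Carrier 0ℓ) → ∃ S →
                      (∃[ b ] (∀ x → S x → x ≤ b)) →
                      ∃[ s ] ((∀ x → S x → x ≤ s) ×
                              (∀ b → (∀ x → S x → x ≤ b) → s ≤ b))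

  infix 4 _<_
  _<_ : Rel Carrier 0ℓ
  x < y = x ≤ y × ¬ (x ≈ y)

  open RawSemiringDefs (Semiring.rawSemiring semiring) public
    using (sum; _^_) renaming (_×_ to _·_)

  fromℕ : ℕ → Carrier
  fromℕ n = n · 1#

-- s(n) = 2^{o(n)}:  for every k,  log₂ s(n) ≤ n / k  for all large n.
SubExponential : (ℕ → ℕ) → Set
SubExponential s =
  ∀ k → ∃[ n₀ ] (∀ n → n₀ ℕ.≤ n → s n ℕ.^ k ℕ.≤ 2 ℕ.^ n)

#fac #cli : ℕ → ℕ
#fac n = 3 ℕ.* n
#cli n = n ℕ.^ 4 ℕ.+ 1

module CFL (𝓡 : RealNumbers) where

  open RealNumbers 𝓡 renaming (Carrier to ℝ)

  -- (n⁴ + 1) − n U = 2^{−n²}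
  IsCapacity : ℕ → ℝ → Set
  IsCapacity n U =
    fromℕ (#cli n) - fromℕ n * U ≈ (fromℕ 2 ⁻¹) ^ (n ℕ.* n)

  record Point (n : ℕ) : Set where
    field
      y : Fin (#fac n) → ℝ
      x : Fin (#fac n) → Fin (#cli n) → ℝ

  open Point

  Binary : ∀ {n} → Point n → Set
  Binary p = ∀ i → y p i ≈ 0# ⊎ y p i ≈ 1#

  InUnitBox : ∀ {n} → Point n → Set
  InUnitBox p = ∀ i j → 0# ≤ x p i j × x p i j ≤ 1#

  record MixedIntegerFeasible (n : ℕ) (U : ℝ) (p : Point n) : Set where
    field
      binary   : Binary p
      box      : InUnitBox p
      assigned : ∀ j → sum (λ i → x p i j) ≈ 1#
      opened   : ∀ i j → x p i j ≤ y p i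
      capacity : ∀ i → sum (λ j → x p i j) ≤ U * y p i

  record ConvexHull {n : ℕ} (S : Pred (Point n) 0ℓ) (p : Point n) : Set where
    field
      k      : ℕ
      weight : Vector ℝ k
      vertex : Vector (Point n) k
      ∈S     : ∀ l → S (vertex l)
      nonNeg : ∀ l → 0# ≤ weight l
      total  : sum weight ≈ 1#
      y-comb : ∀ i → y p i ≈ sum (λ l → weight l * y (vertex l) i)
      x-comb : ∀ i j → x p i j ≈ sum (λ l → weight l * x (vertex l) i j)

  CFLPolytope : (n : ℕ) → ℝ → Pred (Point n) 0ℓ
  CFLPolytope n U = ConvexHull (MixedIntegerFeasible n U)

  -- The affine form  π(y,x) = Σᵢ αᵢ yᵢ + Σᵢⱼ βᵢⱼ xᵢⱼ + γ,  standing for the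
  -- constraint  π(y,x) ≤ 0.
  record Constraint (n : ℕ) : Set where
    field
      α : Fin (#fac n) → ℝ
      β : Fin (#fac n) → Fin (#cli n) → ℝ
      γ : ℝ

  linear : ∀ {n} → (Fin (#fac n) → ℝ) → (Fin (#fac n) → Fin (#cli n) → ℝ) →
           Point n → ℝ
  linear a b p = sum (λ i → a i * y p i) + sum (λ i → sum (λ j → b i j * x p i j))

  Satisfies : ∀ {n} → Point n → Constraint n → Set
  Satisfies p π = linear α β p + γ ≤ 0#
    where open Constraint π

  Description : ℕ → Set
  Description n = List (Constraint n)

  Polyhedron : ∀ {n} → Description n → Pred (Point n) 0ℓ
  Polyhedron D p = All (Satisfies p) D

  IsRelaxation : (n : ℕ) → ℝ → Description n → Set
  IsRelaxation n U D =
    (∀ p → CFLPolytope n U p → Polyhedron D p) ×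
    (∀ p → Binary p → InUnitBox p → Polyhedron D p ⇔ CFLPolytope n U p)

  -- The size belongs to the polyhedron: the minimum is over all descriptions
  -- of the same set of points, of which D need not be a shortest one.
  HasSize : ∀ {n} → Description n → ℕ → Set
  HasSize {n} D s =
    (∃[ D′ ] (Describes D′ × length D′ ≡ s)) ×
    (∀ D′ → Describes D′ → s ℕ.≤ length D′)
    where
    Describes : Description n → Set
    Describes D′ = ∀ p → Polyhedron D′ p ⇔ Polyhedron D p

  -- Monomials  ∏_{i∈S} yᵢ  and  xᵢⱼ ∏_{i′∈S} yᵢ′.  Indexing by the set S
  -- builds in the rule  yᵢ² = yᵢ.
  data Monomial (n : ℕ) : Set where
    yᵐ : Subset (#fac n) → Monomial n
    xᵐ : Subset (#fac n) → Fin (#fac n) → Fin (#cli n) → Monomial n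

  Polynomial : ℕ → Set
  Polynomial n = List (ℝ × Monomial n)

  toPolynomial : ∀ {n} → Constraint n → Polynomial n
  toPolynomial {n} π =
    (γ , yᵐ ∅) ∷
    map (λ i → α i , yᵐ ⁅ i ⁆) (allFin (#fac n)) ++
    map (λ (i , j) → β i j , xᵐ ∅ i j)
        (cartesianProduct (allFin (#fac n)) (allFin (#cli n)))
    where open Constraint π

  timesMonomial : ∀ {n} → Fin (#fac n) → Monomial n → Monomial n
  timesMonomial k (yᵐ S)     = yᵐ (⁅ k ⁆ ∪ S)
  timesMonomial k (xᵐ S i j) = xᵐ (⁅ k ⁆ ∪ S) i j

  times-y times-1-y : ∀ {n} → Fin (#fac n) → Polynomial n → Polynomial n
  times-y   k q = map (λ (r , μ) → r , timesMonomial k μ) q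
  times-1-y k q = q ++ map (λ (r , μ) → - r , timesMonomial k μ) q

  -- π · ∏_{k ∈ A−W} y_k · ∏_{k ∈ W} (1 − y_k),  for W ⊆ A
  lift : ∀ {n} → (A W : Subset (#fac n)) → Constraint n → Polynomial n
  lift {n} A W π = foldr factor (toPolynomial π) (allFin (#fac n))
    where
    factor : Fin (#fac n) → Polynomial n → Polynomial n
    factor k q =
      if does (k ∈? W) then times-1-y k q else
      if does (k ∈? A) then times-y k q else q

  -- Values of the variables y_S and v_{S,ij}.  Those with S too large to arise
  -- at the given level occur in no lifted constraint.
  record LiftedPoint (n : ℕ) : Set where
    field
      yˢ : Subset (#fac n) → ℝ
      vˢ : Subset (#fac n) → Fin (#fac n) → Fin (#cli n) → ℝ

  value : ∀ {n} → LiftedPoint n → Monomial n → ℝ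
  value ℓ (yᵐ S)     = LiftedPoint.yˢ ℓ S
  value ℓ (xᵐ S i j) = LiftedPoint.vˢ ℓ S i j

  linearized : ∀ {n} → LiftedPoint n → Polynomial n → ℝ
  linearized ℓ = foldr (λ (r , μ) acc → r * value ℓ μ + acc) 0#

  record ProjectsTo {n : ℕ} (ℓ : LiftedPoint n) (p : Point n) : Set where
    open LiftedPoint ℓ
    field
      y-empty     : yˢ ∅ ≈ 1#
      y-singleton : ∀ i → yˢ ⁅ i ⁆ ≈ y p i
      v-empty     : ∀ i j → vˢ ∅ i j ≈ x p i j

  SA : ∀ {n} → ℕ → Description n → Pred (Point n) 0ℓ
  SA {n} t D p =
    Σ (LiftedPoint n) λ ℓ → ProjectsTo ℓ p ×
      All (λ π → ∀ (A W : Subset (#fac n)) → ∣ A ∣ ℕ.≤ t → W ⊆ A →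
                 linearized ℓ (lift A W π) ≤ 0#) D

  record Objective (n : ℕ) : Set where
    field
      f : Fin (#fac n) → ℝ
      c : Fin (#fac n) → Fin (#cli n) → ℝ

  record Admissible {n : ℕ} (o : Objective n) : Set where
    open Objective o
    field
      f-nonNeg : ∀ i → 0# ≤ f i
      c-nonNeg : ∀ i j → 0# ≤ c i j
      metric   : ∀ i i′ j j′ → c i j ≤ c i′ j + c i′ j′ + c i j′

  cost : ∀ {n} → Objective n → Point n → ℝ
  cost o = linear f c
    where open Objective o

  -- v is the infimum of the cost over S
  OptimalCost : ∀ {n} → Pred (Point n) 0ℓ → Objective n → ℝ → Set
  OptimalCost S o v =
    (∀ p → S p → v ≤ cost o p) ×
    (∀ u → (∀ p → S p → u ≤ cost o p) → u ≤ v)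

  -- B bounds every ratio v / w of optimal costs.  When v > 0 but the cost over
  -- S is unbounded below or has infimum w ≤ 0, the ratio counts as +∞, so no B
  -- qualifies.  Objectives with v = 0 are left out.
  BoundsRatios : (n : ℕ) → ℝ → Pred (Point n) 0ℓ → ℝ → Set
  BoundsRatios n U S B =
    ∀ (o : Objective n) → Admissible o →
    ∀ v → OptimalCost (MixedIntegerFeasible n U) o v → 0# < v →
    ∃[ w ] (OptimalCost S o w × 0# < w × v * w ⁻¹ ≤ B)

  -- The gap is a supremum in (−∞, +∞], so it is at least r exactly when every
  -- upper bound of the ratios is.
  IntegralityGap≥ : (n : ℕ) → ℝ → Pred (Point n) 0ℓ → ℝ → Set
  IntegralityGap≥ n U S r = ∀ B → BoundsRatios n U S B → r ≤ B

{-# OPTIONS --safe #-}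

-- Group the 3n facilities into n slots, each with two ordinary facilities and
-- one extra facility.  A bit vector b selects one ordinary facility per slot;
-- the n selected facilities are free and lie at the clients, and fall short of
-- the demand by ε = 2^{−n²}.  An integral solution must open an extra facility
-- at cost 1 or send demand ε over distance 1/ε to the unselected facilities,
-- so it costs at least 1.
--
-- The fractional solution is a pseudo-distribution of cost below 1/n: it puts
-- weight 1/(n+n²) on each of n feasible vertices, where one extra facility is
-- open, and the rest on a base vertex that overloads the selected facilities
-- by ε.  A lifted constraint of level t < n leaves some extra facility k free,
-- so it can only fail if the average of the base vertex and the vertex of k,
-- in the proportion n² : 1, violates a constraint of P.
--
-- No valid constraint is violated by the averages of two bit vectors b ≠ b′:
-- at a slot where they differ, the facility selected by b′ is open and unused
-- in the points of b, and vice versa, so exchanging a little demand there turns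
-- the sum of the two averages into a sum of feasible vertices.  Hence a gap
-- below n would require 2ⁿ distinct constraints in every description of P.

module Submission where

open import Defs
open import Algebra.Bundles using (CommutativeRing; RawRing)
import Algebra.Properties.Ring as RingProperties
import Algebra.Properties.Semiring.Mult as SemiringMult
import Algebra.Properties.Semiring.Sum as SemiringSum
import Algebra.Solver.Ring as RingSolver
open import Algebra.Solver.Ring.AlmostCommutativeRing
  using (fromCommutativeRing; _-Raw-AlmostCommutative⟶_)
open import Data.Bool as Bool using (Bool; true; false; if_then_else_; _∧_; not; T)
open import Data.Bool.Properties using (T?)
open import Data.Fin as Fin using (Fin; zero; suc)
import Data.Fin.Properties as Fin
open import Data.Fin.Subset using (Subset; _∈_; _∉_; ⁅_⁆; _∪_; _⊆_; ∣_∣)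
  renaming (⊥ to ∅; _-_ to _∖_)
open import Data.Fin.Subset.Properties
  using (_∈?_; ∉⊥; x∈⁅x⁆; x∈⁅y⁆⇒x≡y; x∈p∪q⁻; p⊆p∪q; q⊆p∪q; p⊆q⇒∣p∣≤∣q∣; x∈p⇒∣p-x∣<∣p∣; x∈p∧x≢y⇒x∈p-y)
open import Data.Integer as ℤ using (ℤ; +_; -[1+_])
import Data.Integer.Properties as ℤ
open import Data.List as List using (List; []; _∷_; _++_; foldr; allFin; cartesianProduct; length)
open import Data.List.Membership.Propositional using () renaming (_∈_ to _∈ˡ_)
open import Data.List.Membership.Propositional.Properties using (∈-allFin; ∈-lookup)
open import Data.List.Properties using (map-++; map-∘; map-tabulate)
open import Data.List.Relation.Unary.All as All using (All)
open import Data.List.Relation.Unary.All.Properties using (¬All⇒Any¬)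
open import Data.List.Relation.Unary.Any as Any using (Any; here; there)
open import Data.List.Relation.Unary.Any.Properties using (lookup-index)
import Data.Maybe as Maybe
open import Data.Nat as ℕ using (ℕ; zero; suc)
import Data.Nat.Properties as ℕ
open import Data.Nat.Solver using (module +-*-Solver)
open import Data.Product using (∃-syntax; _×_; _,_; proj₁; proj₂)
open import Data.Sum using (_⊎_; inj₁; inj₂; [_,_])
open import Function using (_∘_; id; _⇔_; mk⇔; Equivalence)
open import Relation.Binary using (IsDecTotalOrder)
open import Relation.Binary.PropositionalEquality as ≡ using (_≡_; _≢_)
open import Relation.Nullary using (¬_; Dec; yes; no; does; contradiction)
open import Relation.Nullary.Decidable
  using (_→-dec_; _×-dec_; does-⇔; dec-true; dec⇒maybe; decidable-stable)

-- Natural-number bounds, bit vectors and finite subsets.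

suc≤2^ : ∀ n → suc n ℕ.≤ 2 ℕ.^ n
suc≤2^ zero    = ℕ.≤-refl
suc≤2^ (suc n) = ℕ.+-mono-≤ (ℕ.m^n>0 2 n) (ℕ.≤-trans (suc≤2^ n) (ℕ.m≤m+n _ 0))

-- The left side is part of the expansion of `suc n ^ 4`, and `suc n ≤ 2 ^ n`; turning the exponent
-- `4 * n` into `n * n` costs `4 ≤ n`. Scaled by `ε`, this becomes the field `small` of
-- `Parameters`.
cubic≤2^n² : ∀ n → 4 ℕ.≤ n → n ℕ.* n ℕ.* n ℕ.+ n ℕ.+ 1 ℕ.≤ 2 ℕ.^ (n ℕ.* n)
cubic≤2^n² n 4≤n = begin
  n ℕ.* n ℕ.* n ℕ.+ n ℕ.+ 1                     ≤⟨ ℕ.m≤m+n _ _ ⟩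
  (n ℕ.* n ℕ.* n ℕ.+ n ℕ.+ 1) ℕ.+
  (n ℕ.* n ℕ.* n ℕ.* n ℕ.+ 3 ℕ.* (n ℕ.* n ℕ.* n) ℕ.+ 6 ℕ.* (n ℕ.* n) ℕ.+ 3 ℕ.* n)
    ≡⟨ solve 1 (λ n → (n :* n :* n :+ n :+ con 1) :+
         (n :* n :* n :* n :+ con 3 :* (n :* n :* n) :+ con 6 :* (n :* n) :+ con 3 :* n) :=
         (con 1 :+ n) :* ((con 1 :+ n) :* ((con 1 :+ n) :* ((con 1 :+ n) :* con 1)))) ≡.refl n ⟩
  suc n ℕ.^ 4                                   ≤⟨ ℕ.^-monoˡ-≤ 4 (suc≤2^ n) ⟩
  (2 ℕ.^ n) ℕ.^ 4                               ≡⟨ ℕ.^-*-assoc 2 n 4 ⟩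
  2 ℕ.^ (n ℕ.* 4)                               ≤⟨ ℕ.^-monoʳ-≤ 2 (ℕ.*-monoʳ-≤ n 4≤n) ⟩
  2 ℕ.^ (n ℕ.* n)                               ∎
  where
  open ℕ.≤-Reasoning
  open +-*-Solver

s²≤2^n⇒s<2^n : ∀ {s n} → 1 ℕ.≤ n → s ℕ.^ 2 ℕ.≤ 2 ℕ.^ n → s ℕ.< 2 ℕ.^ n
s²≤2^n⇒s<2^n {s} {n} 1≤n s²≤2^n = ℕ.≰⇒> λ 2^n≤s → ℕ.<⇒≱ (begin-strict
  2 ℕ.^ n                        <⟨ ℕ.m<m*n (2 ℕ.^ n) (2 ℕ.^ n) {{ℕ.m^n≢0 2 n}} (ℕ.^-monoʳ-≤ 2 1≤n) ⟩
  2 ℕ.^ n ℕ.* 2 ℕ.^ n            ≤⟨ ℕ.*-mono-≤ 2^n≤s 2^n≤s ⟩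
  s ℕ.* s                        ≡⟨ ≡.cong (s ℕ.*_) (ℕ.*-identityʳ s) ⟨
  s ℕ.^ 2                        ∎) s²≤2^n
  where open ℕ.≤-Reasoning

bit : Fin 2 → Bool
bit zero    = false
bit (suc _) = true

bit-injective : ∀ {c c′} → bit c ≡ bit c′ → c ≡ c′
bit-injective {zero}     {zero}     _ = ≡.refl
bit-injective {suc zero} {suc zero} _ = ≡.refl

-- Base-2 digits: indexing the bit vectors by `Fin (2 ^ n)` prepares them for the pigeonhole
-- principle.
bits : ∀ n → Fin (2 ℕ.^ n) → Fin n → Bool
bits n i k = bit (Fin.finToFun i k)

funToFin-cong : ∀ {m n} (f g : Fin m → Fin n) → (∀ k → f k ≡ g k) → Fin.funToFin f ≡ Fin.funToFin g
funToFin-cong {zero}  f g f≗g = ≡.refl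
funToFin-cong {suc m} f g f≗g = ≡.cong₂ Fin.combine (f≗g zero) (funToFin-cong (f ∘ suc) (g ∘ suc) (f≗g ∘ suc))

bits-injective : ∀ n {i j : Fin (2 ℕ.^ n)} → (∀ k → bits n i k ≡ bits n j k) → i ≡ j
bits-injective n {i} {j} eq = ≡.trans (≡.sym (Fin.funToFin-finToFin {n} {2} i))
  (≡.trans (funToFin-cong (Fin.finToFun i) (Fin.finToFun j) (λ k → bit-injective (eq k))) (Fin.funToFin-finToFin {n} {2} j))

-- Deleting `f zero` from `W` lowers its size, and injectivity keeps the other images inside.
-- Applied to the extra facilities, it shows that a set of fewer than `n` facilities misses one of
-- them.
injection⇒≤∣∣ : ∀ {n N} (W : Subset N) (f : Fin n → Fin N) →
                (∀ {k l} → f k ≡ f l → k ≡ l) → (∀ k → f k ∈ W) → n ℕ.≤ ∣ W ∣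
injection⇒≤∣∣ {zero}  W f inj f∈W = ℕ.z≤n
injection⇒≤∣∣ {suc n} W f inj f∈W = ℕ.<-≤-trans
  (ℕ.s≤s (injection⇒≤∣∣ (W ∖ f zero) (f ∘ suc) (Fin.suc-injective ∘ inj)
    (λ k → x∈p∧x≢y⇒x∈p-y (f∈W (suc k)) (λ eq → contradiction (inj eq) λ ()))))
  (x∈p⇒∣p-x∣<∣p∣ (f∈W zero))

-- Arithmetic and finite sums in an ordered field.

module Reals (𝓡 : RealNumbers) where

  open RealNumbers 𝓡 hiding (zero) renaming (Carrier to ℝ)
  open RingProperties ring public
    using (-0#≈0#; -‿involutive; -‿distribˡ-*; -‿+-comm)
  open SemiringMult semiring public using (×-homo-+; ×1-homo-*)
  private module Sum = SemiringSum semiring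
  open import Relation.Binary.Reasoning.Setoid setoid
  open IsDecTotalOrder isDecTotalOrder public
    using (_≤?_; _≟_; total; antisym; ≤-respˡ-≈; ≤-respʳ-≈)
    renaming (refl to ≤-refl; trans to ≤-trans; reflexive to ≤-reflexive)

  -- The ring solver over 𝓡 needs coefficients that compute.

  embed : ℤ → ℝ
  embed (+ n)    = fromℕ n
  embed -[1+ n ] = - fromℕ (suc n)

  fromℕ-+ : ∀ m n → fromℕ (m ℕ.+ n) ≈ fromℕ m + fromℕ n
  fromℕ-+ m n = ×-homo-+ 1# m n

  fromℕ-* : ∀ m n → fromℕ (m ℕ.* n) ≈ fromℕ m * fromℕ n
  fromℕ-* = ×1-homo-*

  [x+y]-[x+z] : ∀ x y z → (x + y) - (x + z) ≈ y - z
  [x+y]-[x+z] x y z = begin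
    (x + y) - (x + z)       ≈⟨ +-cong (+-comm y x) (-‿+-comm x z) ⟨
    (y + x) + (- x - z)     ≈⟨ +-assoc y x _ ⟩
    y + (x + (- x - z))     ≈⟨ +-congˡ (+-assoc x (- x) (- z)) ⟨
    y + ((x - x) - z)       ≈⟨ +-congˡ (+-congʳ (-‿inverseʳ x)) ⟩
    y + (0# - z)            ≈⟨ +-congˡ (+-identityˡ (- z)) ⟩
    y - z                   ∎

  embed-⊖ : ∀ m n → embed (m ℤ.⊖ n) ≈ fromℕ m - fromℕ n
  embed-⊖ zero    zero    = sym (-‿inverseʳ 0#)
  embed-⊖ zero    (suc n) = sym (+-identityˡ _)
  embed-⊖ (suc m) zero    = sym (trans (+-congˡ -0#≈0#) (+-identityʳ _))
  embed-⊖ (suc m) (suc n) = begin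
    embed (suc m ℤ.⊖ suc n)              ≡⟨ ≡.cong embed (ℤ.[1+m]⊖[1+n]≡m⊖n m n) ⟩
    embed (m ℤ.⊖ n)                      ≈⟨ embed-⊖ m n ⟩
    fromℕ m - fromℕ n                    ≈⟨ [x+y]-[x+z] 1# (fromℕ m) (fromℕ n) ⟨
    fromℕ (suc m) - fromℕ (suc n)        ∎

  embed-neg : ∀ i → embed (ℤ.- i) ≈ - embed i
  embed-neg (+ zero)  = sym -0#≈0#
  embed-neg (+ suc n) = refl
  embed-neg -[1+ n ]  = sym (-‿involutive _)

  embed-+ : ∀ i j → embed (i ℤ.+ j) ≈ embed i + embed j
  embed-+ (+ m)    (+ n)    = fromℕ-+ m n
  embed-+ (+ m)    -[1+ n ] = embed-⊖ m (suc n)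
  embed-+ -[1+ m ] (+ n)    = trans (embed-⊖ n (suc m)) (+-comm _ _)
  embed-+ -[1+ m ] -[1+ n ] = begin
    - fromℕ (suc (suc (m ℕ.+ n)))              ≡⟨ ≡.cong (λ k → - fromℕ (suc k)) (ℕ.+-suc m n) ⟨
    - fromℕ (suc m ℕ.+ suc n)                  ≈⟨ -‿cong (fromℕ-+ (suc m) (suc n)) ⟩
    - (fromℕ (suc m) + fromℕ (suc n))          ≈⟨ -‿+-comm _ _ ⟨
    - fromℕ (suc m) - fromℕ (suc n)            ∎

  embed-*⁺ : ∀ m j → embed (+ m ℤ.* j) ≈ fromℕ m * embed j
  embed-*⁺ zero    j = sym (zeroˡ _)
  embed-*⁺ (suc m) j = begin
    embed (+ suc m ℤ.* j)               ≡⟨ ≡.cong embed (ℤ.suc-* (+ m) j) ⟩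
    embed (j ℤ.+ + m ℤ.* j)             ≈⟨ embed-+ j (+ m ℤ.* j) ⟩
    embed j + embed (+ m ℤ.* j)         ≈⟨ +-cong (sym (*-identityˡ _)) (embed-*⁺ m j) ⟩
    1# * embed j + fromℕ m * embed j    ≈⟨ distribʳ _ _ _ ⟨
    fromℕ (suc m) * embed j             ∎

  embed-* : ∀ i j → embed (i ℤ.* j) ≈ embed i * embed j
  embed-* (+ m)    j = embed-*⁺ m j
  embed-* -[1+ m ] j = begin
    embed (-[1+ m ] ℤ.* j)            ≡⟨ ≡.cong embed (ℤ.neg-distribˡ-* (+ suc m) j) ⟨
    embed (ℤ.- (+ suc m ℤ.* j))       ≈⟨ embed-neg (+ suc m ℤ.* j) ⟩
    - embed (+ suc m ℤ.* j)           ≈⟨ -‿cong (embed-*⁺ (suc m) j) ⟩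
    - (fromℕ (suc m) * embed j)       ≈⟨ -‿distribˡ-* _ _ ⟩
    - fromℕ (suc m) * embed j         ∎

  -- embed (+ 1) is 1# + 0#; the solver should read the constant 1 as 1# itself.
  coefficient : ℤ → ℝ
  coefficient (+ 1) = 1#
  coefficient i     = embed i

  coefficient≈embed : ∀ i → coefficient i ≈ embed i
  coefficient≈embed (+ 0)           = refl
  coefficient≈embed (+ 1)           = sym (+-identityʳ 1#)
  coefficient≈embed (+ suc (suc n)) = refl
  coefficient≈embed -[1+ n ]        = refl

  private
    ℤ-rawRing : RawRing _ _
    ℤ-rawRing = CommutativeRing.rawRing ℤ.+-*-commutativeRing

    coefficient-homo : ℤ-rawRing -Raw-AlmostCommutative⟶ fromCommutativeRing commutativeRing
    coefficient-homo = record
      { ⟦_⟧    = coefficient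
      ; +-homo = λ i j → transport i j (coefficient≈embed (i ℤ.+ j)) (embed-+ i j) +-cong
      ; *-homo = λ i j → transport i j (coefficient≈embed (i ℤ.* j)) (embed-* i j) *-cong
      ; -‿homo = λ i → trans (coefficient≈embed (ℤ.- i))
                         (trans (embed-neg i) (-‿cong (sym (coefficient≈embed i))))
      ; 0-homo = refl
      ; 1-homo = refl
      }
      where
      transport : ∀ i j {x y} {_∙_ : ℝ → ℝ → ℝ} → x ≈ y → y ≈ embed i ∙ embed j →
                  (∀ {x y u v} → x ≈ y → u ≈ v → x ∙ u ≈ y ∙ v) →
                  x ≈ coefficient i ∙ coefficient j
      transport i j x≈ ≈∙ ∙-cong =
        trans x≈ (trans ≈∙ (∙-cong (sym (coefficient≈embed i)) (sym (coefficient≈embed j))))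

  open RingSolver ℤ-rawRing (fromCommutativeRing commutativeRing) coefficient-homo
    (λ i j → Maybe.map (reflexive ∘ ≡.cong coefficient) (dec⇒maybe (i ℤ.≟ j)))
    public using (solve; con; _:=_; _:+_; _:*_; _:-_; :-_)

  -- Proves identities modulo a hypothesis: the solver checks that `l - r` is the multiple `c` of
  -- `h - h′`, and the hypothesis annihilates that multiple. Reciprocals and the capacity equation
  -- enter the computations in this way.
  by-relation : ∀ {h h′ l r} c → h ≈ h′ → l ≈ r + c * (h - h′) → l ≈ r
  by-relation {h} {h′} {l} {r} c h≈h′ eq = begin
    l                 ≈⟨ eq ⟩
    r + c * (h - h′)  ≈⟨ +-congˡ (*-congˡ (trans (+-congʳ h≈h′) (-‿inverseʳ h′))) ⟩
    r + c * 0#        ≈⟨ +-congˡ (zeroʳ c) ⟩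
    r + 0#            ≈⟨ +-identityʳ r ⟩
    r                 ∎

  ≤-≈ : ∀ {x y} → x ≈ y → x ≤ y
  ≤-≈ = ≤-reflexive

  ≤-resp-≈ : ∀ {x x′ y y′} → x ≈ x′ → y ≈ y′ → x ≤ y → x′ ≤ y′
  ≤-resp-≈ x≈x′ y≈y′ x≤y = ≤-respˡ-≈ x≈x′ (≤-respʳ-≈ y≈y′ x≤y)

  +-mono-≤ : ∀ {x y u v} → x ≤ y → u ≤ v → x + u ≤ y + v
  +-mono-≤ {x} {y} {u} {v} x≤y u≤v =
    ≤-trans (+-monoʳ-≤ x u≤v) (≤-resp-≈ (+-comm v x) (+-comm v y) (+-monoʳ-≤ v x≤y))

  +-nonNeg : ∀ {x y} → 0# ≤ x → 0# ≤ y → 0# ≤ x + y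
  +-nonNeg 0≤x 0≤y = ≤-respˡ-≈ (+-identityˡ 0#) (+-mono-≤ 0≤x 0≤y)

  +-nonPos : ∀ {x y} → x ≤ 0# → y ≤ 0# → x + y ≤ 0#
  +-nonPos x≤0 y≤0 = ≤-respʳ-≈ (+-identityˡ 0#) (+-mono-≤ x≤0 y≤0)

  x≤x+nonNeg : ∀ {x d} → 0# ≤ d → x ≤ x + d
  x≤x+nonNeg {x} 0≤d = ≤-respˡ-≈ (+-identityʳ x) (+-monoʳ-≤ x 0≤d)

  -- An inequality is certified by naming its slack `d`, which leaves an equation for the ring
  -- solver.
  ≤-gap : ∀ {x y d} → 0# ≤ d → y ≈ x + d → x ≤ y
  ≤-gap 0≤d y≈x+d = ≤-respʳ-≈ (sym y≈x+d) (x≤x+nonNeg 0≤d)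

  x≤y⇒0≤y-x : ∀ {x y} → x ≤ y → 0# ≤ y - x
  x≤y⇒0≤y-x {x} {y} x≤y =
    ≤-resp-≈ (-‿inverseˡ x) (+-comm (- x) y) (+-monoʳ-≤ (- x) x≤y)

  *-monoˡ-≤ : ∀ {x y z} → 0# ≤ z → x ≤ y → z * x ≤ z * y
  *-monoˡ-≤ {x} {y} {z} 0≤z x≤y = ≤-gap (*-nonNeg 0≤z (x≤y⇒0≤y-x x≤y))
    (solve 3 (λ x y z → z :* y := z :* x :+ z :* (y :- x)) refl x y z)

  *-nonPos : ∀ {x y} → 0# ≤ x → y ≤ 0# → x * y ≤ 0#
  *-nonPos {x} 0≤x y≤0 = ≤-respʳ-≈ (zeroʳ x) (*-monoˡ-≤ 0≤x y≤0)

  ≰⇒≥ : ∀ {x y} → ¬ x ≤ y → y ≤ x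
  ≰⇒≥ {x} {y} x≰y with total x y
  ... | inj₁ x≤y = contradiction x≤y x≰y
  ... | inj₂ y≤x = y≤x

  0≤x² : ∀ x → 0# ≤ x * x
  0≤x² x with total 0# x
  ... | inj₁ 0≤x = *-nonNeg 0≤x 0≤x
  ... | inj₂ x≤0 = ≤-respʳ-≈ (solve 1 (λ x → (con (+ 0) :- x) :* (con (+ 0) :- x) := x :* x) refl x)
                     (*-nonNeg (x≤y⇒0≤y-x x≤0) (x≤y⇒0≤y-x x≤0))

  0≤1 : 0# ≤ 1#
  0≤1 = ≤-respʳ-≈ (*-identityʳ 1#) (0≤x² 1#)

  fromℕ-nonNeg : ∀ n → 0# ≤ fromℕ n
  fromℕ-nonNeg zero    = ≤-refl
  fromℕ-nonNeg (suc n) = +-nonNeg 0≤1 (fromℕ-nonNeg n)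

  fromℕ-mono : ∀ {m n} → m ℕ.≤ n → fromℕ m ≤ fromℕ n
  fromℕ-mono {n = n} ℕ.z≤n = fromℕ-nonNeg n
  fromℕ-mono (ℕ.s≤s m≤n)  = +-monoʳ-≤ 1# (fromℕ-mono m≤n)

  1≤x⇒x≉0 : ∀ {x} → 1# ≤ x → ¬ x ≈ 0#
  1≤x⇒x≉0 1≤x x≈0 = 0≉1 (antisym 0≤1 (≤-respʳ-≈ x≈0 1≤x))

  1≤fromℕ : ∀ {n} → 1 ℕ.≤ n → 1# ≤ fromℕ n
  1≤fromℕ {suc n} _ = x≤x+nonNeg (fromℕ-nonNeg n)

  ⁻¹-nonNeg : ∀ {x} → 0# ≤ x → ¬ x ≈ 0# → 0# ≤ x ⁻¹
  ⁻¹-nonNeg {x} 0≤x x≉0 = ≤-respʳ-≈ eq (*-nonNeg 0≤x (0≤x² (x ⁻¹)))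
    where
    eq : x * (x ⁻¹ * x ⁻¹) ≈ x ⁻¹
    eq = by-relation (x ⁻¹) (⁻¹-inverseʳ x x≉0)
      (solve 2 (λ x z → x :* (z :* z) := z :+ z :* (x :* z :- con (+ 1))) refl x (x ⁻¹))

  ⁻¹-nonZero : ∀ {x} → ¬ x ≈ 0# → ¬ x ⁻¹ ≈ 0#
  ⁻¹-nonZero {x} x≉0 x⁻¹≈0 =
    0≉1 (trans (sym (trans (*-congˡ x⁻¹≈0) (zeroʳ x))) (⁻¹-inverseʳ x x≉0))

  -- The library's lemmas, restated for the sum of Defs, which unification does
  -- not identify with the library's.

  sum-cong : ∀ {n} {f h : Fin n → ℝ} → (∀ i → f i ≈ h i) → sum f ≈ sum h
  sum-cong = Sum.sum-cong-≋

  sum-+ : ∀ {n} (f h : Fin n → ℝ) → sum (λ i → f i + h i) ≈ sum f + sum h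
  sum-+ = Sum.∑-distrib-+

  *-sum : ∀ {n} r (f : Fin n → ℝ) → r * sum f ≈ sum (λ i → r * f i)
  *-sum = Sum.*-distribˡ-sum

  sum-comm : ∀ {m n} (f : Fin m → Fin n → ℝ) →
             sum (λ i → sum (λ j → f i j)) ≈ sum (λ j → sum (λ i → f i j))
  sum-comm = Sum.∑-comm

  sum-mono : ∀ {n} {f h : Fin n → ℝ} → (∀ i → f i ≤ h i) → sum f ≤ sum h
  sum-mono {zero}  f≤h = ≤-refl
  sum-mono {suc n} f≤h = +-mono-≤ (f≤h zero) (sum-mono (f≤h ∘ suc))

  sum-nonNeg : ∀ {n} {f : Fin n → ℝ} → (∀ i → 0# ≤ f i) → 0# ≤ sum f
  sum-nonNeg {zero}  0≤f = ≤-refl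
  sum-nonNeg {suc n} 0≤f = +-nonNeg (0≤f zero) (sum-nonNeg (0≤f ∘ suc))

  sum-nonPos : ∀ {n} {f : Fin n → ℝ} → (∀ i → f i ≤ 0#) → sum f ≤ 0#
  sum-nonPos {zero}  f≤0 = ≤-refl
  sum-nonPos {suc n} f≤0 = +-nonPos (f≤0 zero) (sum-nonPos (f≤0 ∘ suc))

  sum-zero : ∀ {n} {f : Fin n → ℝ} → (∀ i → f i ≈ 0#) → sum f ≈ 0#
  sum-zero {n} f≈0 = trans (sum-cong f≈0) (Sum.sum-replicate-zero n)

  term≤sum : ∀ {n} {f : Fin n → ℝ} → (∀ i → 0# ≤ f i) → ∀ k → f k ≤ sum f
  term≤sum 0≤f zero    = x≤x+nonNeg (sum-nonNeg (0≤f ∘ suc))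
  term≤sum {f = f} 0≤f (suc k) =
    ≤-trans (term≤sum (0≤f ∘ suc) k) (≤-gap (0≤f zero) (+-comm (f zero) _))

  -- One term pays for `y`, and the others can only help. In `survives`, `y` is the contribution of
  -- the infeasible base vertex and `k` the vertex paired with it.
  sum-nonPos-at : ∀ {n} {f : Fin n → ℝ} k {y} → (∀ i → f i ≤ 0#) → y + f k ≤ 0# → y + sum f ≤ 0#
  sum-nonPos-at zero f≤0 y+fk≤0 =
    ≤-respˡ-≈ (+-assoc _ _ _) (+-nonPos y+fk≤0 (sum-nonPos (f≤0 ∘ suc)))
  sum-nonPos-at {f = f} (suc k) {y} f≤0 y+fk≤0 =
    ≤-respˡ-≈ (solve 3 (λ a y s → a :+ (y :+ s) := y :+ (a :+ s)) refl (f zero) y (sum (f ∘ suc)))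
      (+-nonPos (f≤0 zero) (sum-nonPos-at k (f≤0 ∘ suc) y+fk≤0))

  sum-const : ∀ n {v} → sum {n} (λ _ → v) ≈ fromℕ n * v
  sum-const zero    {v} = sym (zeroˡ v)
  sum-const (suc n) {v} = trans (+-congˡ (sum-const n))
    (solve 2 (λ v w → v :+ w :* v := (con (+ 1) :+ w) :* v) refl v (fromℕ n))

  single : ∀ {n} → Fin n → ℝ → Fin n → ℝ
  single k v l = if does (l Fin.≟ k) then v else 0#

  sum-single : ∀ {n} (k : Fin n) v → sum (single k v) ≈ v
  sum-single {suc n} zero v = trans (+-congˡ (sum-zero {n} {λ _ → 0#} (λ _ → refl))) (+-identityʳ v)
  sum-single (suc k) v = trans (+-identityˡ _) (trans (sum-cong shift) (sum-single k v))
    where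
    shift : ∀ l → single (suc k) v (suc l) ≈ single k v l
    shift l with l Fin.≟ k
    ... | yes _ = refl
    ... | no  _ = refl

  sum-splitAt : ∀ m {n} (f : Fin (m ℕ.+ n) → ℝ) →
                sum f ≈ sum (λ i → f (i Fin.↑ˡ n)) + sum (λ j → f (m Fin.↑ʳ j))
  sum-splitAt zero    f = sym (+-identityˡ _)
  sum-splitAt (suc m) f = trans (+-congˡ (sum-splitAt m (f ∘ suc))) (sym (+-assoc _ _ _))

  sum-combine : ∀ m {n} (f : Fin (m ℕ.* n) → ℝ) →
                sum f ≈ sum {m} (λ a → sum {n} (λ k → f (Fin.combine a k)))
  sum-combine zero        f = refl
  sum-combine (suc m) {n} f =
    trans (sum-splitAt n f) (+-congˡ (sum-combine m (λ j → f (n Fin.↑ʳ j))))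

-- Linearized constraints and their values at mixtures.

module Linearization (𝓡 : RealNumbers) where

  open RealNumbers 𝓡 hiding (zero) renaming (Carrier to ℝ)
  open CFL 𝓡
  open Reals 𝓡
  open Point
  open LiftedPoint
  open import Relation.Binary.Reasoning.Setoid setoid

  ind : Bool → ℝ
  ind b = if b then 1# else 0#

  ind-∧ : ∀ a b → ind (a ∧ b) ≈ ind a * ind b
  ind-∧ true  b = sym (*-identityˡ _)
  ind-∧ false b = sym (zeroˡ _)

  ind-nonNeg : ∀ b → 0# ≤ ind b
  ind-nonNeg true  = 0≤1
  ind-nonNeg false = ≤-refl

  affine : ∀ {n} → Constraint n → Point n → ℝ
  affine π p = linear (Constraint.α π) (Constraint.β π) p + Constraint.γ π

  linearized-++ : ∀ {n} (ℓ : LiftedPoint n) (q r : Polynomial n) →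
                  linearized ℓ (q ++ r) ≈ linearized ℓ q + linearized ℓ r
  linearized-++ ℓ []      r = sym (+-identityˡ _)
  linearized-++ ℓ (m ∷ q) r = trans (+-congˡ (linearized-++ ℓ q r)) (sym (+-assoc _ _ _))

  linearized-tabulate : ∀ {n k} (ℓ : LiftedPoint n) (h : Fin k → ℝ × Monomial n) →
    linearized ℓ (List.tabulate h) ≈ sum (λ i → proj₁ (h i) * value ℓ (proj₂ (h i)))
  linearized-tabulate {k = zero}  ℓ h = refl
  linearized-tabulate {k = suc k} ℓ h = +-congˡ (linearized-tabulate ℓ (h ∘ suc))

  linearized-map-allFin : ∀ {n} k (ℓ : LiftedPoint n) (h : Fin k → ℝ × Monomial n) →
    linearized ℓ (List.map h (allFin k)) ≈ sum (λ i → proj₁ (h i) * value ℓ (proj₂ (h i)))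
  linearized-map-allFin k ℓ h =
    trans (reflexive (≡.cong (linearized ℓ) (map-tabulate id h))) (linearized-tabulate ℓ h)

  linearized-map-cartesianProduct :
    ∀ {n K k} {A : Set} (ℓ : LiftedPoint n) (g : Fin K → A) (h : A × Fin k → ℝ × Monomial n) →
    linearized ℓ (List.map h (cartesianProduct (List.tabulate g) (allFin k))) ≈
    sum (λ a → sum (λ j → proj₁ (h (g a , j)) * value ℓ (proj₂ (h (g a , j)))))
  linearized-map-cartesianProduct {K = zero} ℓ g h = refl
  linearized-map-cartesianProduct {K = suc K} {k} ℓ g h = begin
    linearized ℓ (List.map h (row ++ rest))
      ≡⟨ ≡.cong (linearized ℓ) (map-++ h row rest) ⟩
    linearized ℓ (List.map h row ++ List.map h rest)
      ≈⟨ linearized-++ ℓ (List.map h row) _ ⟩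
    linearized ℓ (List.map h row) + linearized ℓ (List.map h rest)
      ≡⟨ ≡.cong (λ q → linearized ℓ q + linearized ℓ (List.map h rest)) (map-∘ {g = h} {f = g zero ,_} (allFin k)) ⟨
    linearized ℓ (List.map (λ j → h (g zero , j)) (allFin k)) + linearized ℓ (List.map h rest)
      ≈⟨ +-cong (linearized-map-allFin k ℓ (λ j → h (g zero , j)))
                (linearized-map-cartesianProduct ℓ (g ∘ suc) h) ⟩
    _ ∎
    where
    row  = List.map (g zero ,_) (allFin k)
    rest = cartesianProduct (List.tabulate (g ∘ suc)) (allFin k)

  linearized-toPolynomial : ∀ {n} {ℓ : LiftedPoint n} {p} → ProjectsTo ℓ p → ∀ π →
                            linearized ℓ (toPolynomial π) ≈ affine π p
  linearized-toPolynomial {n} {ℓ} {p} ℓ↦p π = begin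
    γ * yˢ ℓ ∅ + linearized ℓ (yPart ++ xPart)
      ≈⟨ +-cong (trans (*-congˡ y-empty) (*-identityʳ γ)) (linearized-++ ℓ yPart xPart) ⟩
    γ + (linearized ℓ yPart + linearized ℓ xPart)
      ≈⟨ +-congˡ (+-cong
           (trans (linearized-map-allFin (#fac n) ℓ (λ i → α i , yᵐ ⁅ i ⁆)) (sum-cong (λ i → *-congˡ {α i} (y-singleton i))))
           (trans (linearized-map-cartesianProduct ℓ id (λ (i , j) → β i j , xᵐ ∅ i j))
             (sum-cong (λ i → sum-cong (λ j → *-congˡ {β i j} (v-empty i j)))))) ⟩
    γ + linear α β p
      ≈⟨ +-comm γ _ ⟩
    linear α β p + γ ∎
    where
    open Constraint π
    open ProjectsTo ℓ↦p
    yPart xPart : Polynomial n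
    yPart = List.map (λ i → α i , yᵐ ⁅ i ⁆) (allFin (#fac n))
    xPart = List.map (λ (i , j) → β i j , xᵐ ∅ i j) (cartesianProduct (allFin (#fac n)) (allFin (#cli n)))

  mixture : ∀ {n k} → (Fin k → ℝ) → (Fin k → LiftedPoint n) → LiftedPoint n
  mixture w ℓs = record
    { yˢ = λ S → sum (λ l → w l * yˢ (ℓs l) S)
    ; vˢ = λ S i j → sum (λ l → w l * vˢ (ℓs l) S i j)
    }

  value-mixture : ∀ {n k} (w : Fin k → ℝ) (ℓs : Fin k → LiftedPoint n) μ →
                  value (mixture w ℓs) μ ≈ sum (λ l → w l * value (ℓs l) μ)
  value-mixture w ℓs (yᵐ S)     = refl
  value-mixture w ℓs (xᵐ S i j) = refl

  -- Linearization is linear in the lifted point, so a lifted constraint can be evaluated vertex by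
  -- vertex.
  linearized-mixture : ∀ {n k} (w : Fin k → ℝ) (ℓs : Fin k → LiftedPoint n) q →
                       linearized (mixture w ℓs) q ≈ sum (λ l → w l * linearized (ℓs l) q)
  linearized-mixture w ℓs []            = sym (sum-zero (λ l → zeroʳ (w l)))
  linearized-mixture w ℓs ((r , μ) ∷ q) = begin
    r * value (mixture w ℓs) μ + linearized (mixture w ℓs) q
      ≈⟨ +-cong (*-congˡ (value-mixture w ℓs μ)) (linearized-mixture w ℓs q) ⟩
    r * sum (λ l → w l * value (ℓs l) μ) + sum (λ l → w l * linearized (ℓs l) q)
      ≈⟨ +-congʳ (*-sum r (λ l → w l * value (ℓs l) μ)) ⟩
    sum (λ l → r * (w l * value (ℓs l) μ)) + sum (λ l → w l * linearized (ℓs l) q)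
      ≈⟨ sum-+ (λ l → r * (w l * value (ℓs l) μ)) (λ l → w l * linearized (ℓs l) q) ⟨
    sum (λ l → r * (w l * value (ℓs l) μ) + w l * linearized (ℓs l) q)
      ≈⟨ sum-cong (λ l → solve 4 (λ r w v c → r :* (w :* v) :+ w :* c := w :* (r :* v :+ c))
                             refl r (w l) (value (ℓs l) μ) (linearized (ℓs l) q)) ⟩
    sum (λ l → w l * (r * value (ℓs l) μ + linearized (ℓs l) q)) ∎

  -- Lifted constraints at 0/1 vertices.

  Covers : ∀ {N} → (Fin N → Bool) → Subset N → Set
  Covers o S = ∀ i → i ∈ S → T (o i)

  covers? : ∀ {N} (o : Fin N → Bool) S → Dec (Covers o S)
  covers? o S = Fin.all? (λ i → (i ∈? S) →-dec T? (o i))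

  -- The value of the monomial `∏_{i∈S} yᵢ` at the 0/1 vector `o`, written as one indicator so that
  -- set identities translate directly.
  χ : ∀ {N} → (Fin N → Bool) → Subset N → ℝ
  χ o S = ind (does (covers? o S))

  χ-∅ : ∀ {N} (o : Fin N → Bool) → χ o ∅ ≈ 1#
  χ-∅ o = reflexive (≡.cong ind (dec-true (covers? o ∅) (λ i i∈∅ → contradiction i∈∅ ∉⊥)))

  χ-⁅⁆ : ∀ {N} (o : Fin N → Bool) k → χ o ⁅ k ⁆ ≈ ind (o k)
  χ-⁅⁆ o k = reflexive (≡.cong ind (does-⇔ (mk⇔ to from) (covers? o ⁅ k ⁆) (T? (o k))))
    where
    to : Covers o ⁅ k ⁆ → T (o k)
    to c = c k (x∈⁅x⁆ k)
    from : T (o k) → Covers o ⁅ k ⁆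
    from t i i∈k = ≡.subst (T ∘ o) (≡.sym (x∈⁅y⁆⇒x≡y k i∈k)) t

  -- If `k` already lies in `S`, the indicator of `S` absorbs the extra factor; this is the rule
  -- `yᵢ² = yᵢ`.
  χ-∪ : ∀ {N} (o : Fin N → Bool) k S → χ o (⁅ k ⁆ ∪ S) ≈ ind (o k) * χ o S
  χ-∪ o k S = trans
    (reflexive (≡.cong ind (does-⇔ (mk⇔ to from) (covers? o (⁅ k ⁆ ∪ S)) (T? (o k) ×-dec covers? o S))))
    (ind-∧ (o k) (does (covers? o S)))
    where
    to : Covers o (⁅ k ⁆ ∪ S) → T (o k) × Covers o S
    to c = c k (p⊆p∪q S (x∈⁅x⁆ k)) , λ i i∈S → c i (q⊆p∪q ⁅ k ⁆ S i∈S)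
    from : T (o k) × Covers o S → Covers o (⁅ k ⁆ ∪ S)
    from (t , c) i i∈ with x∈p∪q⁻ ⁅ k ⁆ S i∈
    ... | inj₁ i∈k = ≡.subst (T ∘ o) (≡.sym (x∈⁅y⁆⇒x≡y k i∈k)) t
    ... | inj₂ i∈S = c i i∈S

  module AtVertex {n} (o : Fin (#fac n) → Bool) (x : Fin (#fac n) → Fin (#cli n) → ℝ) where

    point : Point n
    point = record { y = ind ∘ o ; x = x }

    -- The moments of a point mass: products of the `y` variables take their true values. `x` is
    -- arbitrary, so this also covers the base vertex, which exceeds the capacities.
    lifted : LiftedPoint n
    lifted = record { yˢ = χ o ; vˢ = λ S i j → χ o S * x i j }

    lifted↦point : ProjectsTo lifted point
    lifted↦point = record
      { y-empty     = χ-∅ o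
      ; y-singleton = χ-⁅⁆ o
      ; v-empty     = λ i j → trans (*-congʳ (χ-∅ o)) (*-identityˡ _)
      }

    value-times : ∀ k μ → value lifted (timesMonomial k μ) ≈ ind (o k) * value lifted μ
    value-times k (yᵐ S)     = χ-∪ o k S
    value-times k (xᵐ S i j) = trans (*-congʳ (χ-∪ o k S)) (*-assoc _ _ _)

    linearized-times : ∀ k q → linearized lifted (times-y k q) ≈ ind (o k) * linearized lifted q
    linearized-times k []            = sym (zeroʳ _)
    linearized-times k ((r , μ) ∷ q) = trans
      (+-cong (*-congˡ (value-times k μ)) (linearized-times k q))
      (solve 4 (λ r i v c → r :* (i :* v) :+ i :* c := i :* (r :* v :+ c))
        refl r (ind (o k)) (value lifted μ) (linearized lifted q))

    linearized-times-neg : ∀ k q →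
      linearized lifted (List.map (λ (r , μ) → - r , timesMonomial k μ) q) ≈ - (ind (o k) * linearized lifted q)
    linearized-times-neg k []            = sym (trans (-‿cong (zeroʳ _)) -0#≈0#)
    linearized-times-neg k ((r , μ) ∷ q) = trans
      (+-cong (*-congˡ (value-times k μ)) (linearized-times-neg k q))
      (solve 4 (λ r i v c → (:- r) :* (i :* v) :- i :* c := :- (i :* (r :* v :+ c)))
        refl r (ind (o k)) (value lifted μ) (linearized lifted q))

    linearized-times-1- : ∀ k q →
      linearized lifted (times-1-y k q) ≈ ind (not (o k)) * linearized lifted q
    linearized-times-1- k q = begin
      linearized lifted (times-1-y k q)                          ≈⟨ linearized-++ lifted q (List.map (λ (r , μ) → - r , timesMonomial k μ) q) ⟩
      L + linearized lifted (List.map (λ (r , μ) → - r , timesMonomial k μ) q)                                    ≈⟨ +-congˡ (linearized-times-neg k q) ⟩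
      L - ind (o k) * L                                          ≈⟨ complement (o k) ⟩
      ind (not (o k)) * L                                        ∎
      where
      L = linearized lifted q
      complement : ∀ b → L - ind b * L ≈ ind (not b) * L
      complement true  = solve 1 (λ l → l :- con (+ 1) :* l := con (+ 0) :* l) refl L
      complement false = solve 1 (λ l → l :- con (+ 0) :* l := con (+ 1) :* l) refl L

    module _ (A W : Subset (#fac n)) where

      -- whether the factor of facility k in ∏_{A−W} y ∏_W (1−y) is 1 at this vertex
      factor : Fin (#fac n) → Bool
      factor k = if does (k ∈? W) then not (o k) else
                 if does (k ∈? A) then o k else true

      -- At a point mass linearization is multiplicative, so each factor `y_k` or `1 - y_k` acts as
      -- a scalar 0 or 1. Hence a lifted constraint is there either the original one or trivial, as
      -- `lift-kept` and `lift-killed` record.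
      linearized-factor : ∀ k q →
        linearized lifted (if does (k ∈? W) then times-1-y k q else
                           if does (k ∈? A) then times-y k q else q) ≈
        ind (factor k) * linearized lifted q
      linearized-factor k q with does (k ∈? W) | does (k ∈? A)
      ... | true  | _     = linearized-times-1- k q
      ... | false | true  = linearized-times k q
      ... | false | false = sym (*-identityˡ _)

    foldr-one : (f : Fin (#fac n) → Polynomial n → Polynomial n) (φ : Fin (#fac n) → Bool) →
      (∀ k q → linearized lifted (f k q) ≈ ind (φ k) * linearized lifted q) →
      (∀ k → T (φ k)) → ∀ q ks → linearized lifted (foldr f q ks) ≈ linearized lifted q
    foldr-one f φ step φ≡1 q []       = refl
    foldr-one f φ step φ≡1 q (k ∷ ks) = begin
      linearized lifted (f k (foldr f q ks))              ≈⟨ step k _ ⟩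
      ind (φ k) * linearized lifted (foldr f q ks)        ≈⟨ *-cong (one (φ k) (φ≡1 k)) (foldr-one f φ step φ≡1 q ks) ⟩
      1# * linearized lifted q                            ≈⟨ *-identityˡ _ ⟩
      linearized lifted q                                 ∎
      where
      one : ∀ b → T b → ind b ≈ 1#
      one true _ = refl

    foldr-zero : (f : Fin (#fac n) → Polynomial n → Polynomial n) (φ : Fin (#fac n) → Bool) →
      (∀ k q → linearized lifted (f k q) ≈ ind (φ k) * linearized lifted q) →
      ∀ {i} → ¬ T (φ i) → ∀ q {ks} → i ∈ˡ ks → linearized lifted (foldr f q ks) ≈ 0#
    foldr-zero f φ step {i} φi≡0 q {k ∷ ks} (here ≡.refl) =
      trans (step k _) (trans (*-congʳ (none (φ k) φi≡0)) (zeroˡ _))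
      where
      none : ∀ b → ¬ T b → ind b ≈ 0#
      none true  ¬t = contradiction _ ¬t
      none false _  = refl
    foldr-zero f φ step φi≡0 q {k ∷ ks} (there i∈ks) =
      trans (step k _) (trans (*-congˡ (foldr-zero f φ step φi≡0 q i∈ks)) (zeroʳ _))

    lift-kept : ∀ A W π → (∀ k → T (factor A W k)) → linearized lifted (lift A W π) ≈ affine π point
    lift-kept A W π kept = trans
      (foldr-one _ (factor A W) (linearized-factor A W) kept (toPolynomial π) (allFin (#fac n)))
      (linearized-toPolynomial lifted↦point π)

    lift-killed : ∀ A W π {k} → ¬ T (factor A W k) → linearized lifted (lift A W π) ≈ 0#
    lift-killed A W π {k} killed =
      foldr-zero _ (factor A W) (linearized-factor A W) killed (toPolynomial π) (∈-allFin k)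

    kept? : ∀ A W → Dec (∀ k → T (factor A W k))
    kept? A W = Fin.all? (λ k → T? (factor A W k))

    lift-dichotomy : ∀ A W π → linearized lifted (lift A W π) ≈ affine π point ⊎
                               linearized lifted (lift A W π) ≈ 0#
    lift-dichotomy A W π with kept? A W
    ... | yes kept = inj₁ (lift-kept A W π kept)
    ... | no ¬kept with Fin.¬∀⟶∃¬ _ _ (λ k → T? (factor A W k)) ¬kept
    ...   | k , killed = inj₂ (lift-killed A W π {k} killed)

-- Classification of the facilities by a bit vector.

data Kind (n : ℕ) : Set where
  selected unselected extra : Fin n → Kind n

-- A bit vector b splits the 2n facilities (0 , k), (1 , k) into n selected
-- and n unselected ones; the facilities (2 , k) are the extra ones.
kindAt : ∀ {n} → (Fin n → Bool) → Fin 3 × Fin n → Kind n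
kindAt b (zero         , k) = if b k then selected k else unselected k
kindAt b (suc zero     , k) = if b k then unselected k else selected k
kindAt b (suc (suc _)  , k) = extra k

kind : ∀ {n} → (Fin n → Bool) → Fin (#fac n) → Kind n
kind {n} b i = kindAt b (Fin.remQuot {3} n i)

extraFacility : ∀ {n} → Fin n → Fin (#fac n)
extraFacility = Fin.combine {3} (suc (suc zero))

extraFacility-injective : ∀ {n} {k l : Fin n} → extraFacility k ≡ extraFacility l → k ≡ l
extraFacility-injective {k = k} {l} = Fin.combine-injectiveʳ {3} (suc (suc zero)) k (suc (suc zero)) l

kindAt-extra : ∀ {n} (b : Fin n → Bool) ak {k} → kindAt b ak ≡ extra k → ak ≡ (suc (suc zero) , k)
kindAt-extra b (zero , l) eq with b l
... | true  = contradiction eq λ ()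
... | false = contradiction eq λ ()
kindAt-extra b (suc zero , l) eq with b l
... | true  = contradiction eq λ ()
... | false = contradiction eq λ ()
kindAt-extra b (suc (suc zero) , l) ≡.refl = ≡.refl

kind-extra⁻ : ∀ {n} (b : Fin n → Bool) i {k} → kind b i ≡ extra k → i ≡ extraFacility k
kind-extra⁻ {n} b i {k} eq = ≡.trans (≡.sym (Fin.combine-remQuot {3} n i))
  (≡.cong (λ (a , l) → Fin.combine {3} a l) (kindAt-extra b (Fin.remQuot {3} n i) eq))

kind-extra : ∀ {n} (b : Fin n → Bool) k → kind b (extraFacility k) ≡ extra k
kind-extra b k = ≡.cong (kindAt b) (Fin.remQuot-combine {3} (suc (suc zero)) k)

alloc : ∀ {n} {X : Set} → (Fin n → X) → (Fin n → X) → (Fin n → X) → Kind n → X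
alloc s u e (selected k)   = s k
alloc s u e (unselected k) = u k
alloc s u e (extra k)      = e k

-- Sums over facilities and combinations of points.

module Construction (𝓡 : RealNumbers) where

  open RealNumbers 𝓡 hiding (zero) renaming (Carrier to ℝ)
  open CFL 𝓡
  open Reals 𝓡
  open Linearization 𝓡
  open Point
  open LiftedPoint
  open import Relation.Binary.Reasoning.Setoid setoid

  -- In each slot, rows 0 and 1 hold the selected and the unselected facility in an order given by
  -- `b k`, which addition ignores.
  sum-kind : ∀ {n} (b : Fin n → Bool) (h : Kind n → ℝ) →
    sum (λ i → h (kind b i)) ≈ sum (h ∘ selected) + sum (h ∘ unselected) + sum (h ∘ extra)
  sum-kind {n} b h = begin
    sum (λ i → h (kind b i))
      ≈⟨ sum-combine 3 {n} (λ i → h (kind b i)) ⟩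
    sum {3} (λ a → sum {n} (λ k → h (kind b (Fin.combine a k))))
      ≈⟨ sum-cong {3} (λ a → sum-cong {n} (λ k →
           reflexive (≡.cong (h ∘ kindAt b) (Fin.remQuot-combine {3} a k)))) ⟩
    sum h₀ + (sum h₁ + (sum (h ∘ extra) + 0#))
      ≈⟨ solve 3 (λ x y z → x :+ (y :+ (z :+ con (+ 0))) := x :+ y :+ z) refl (sum h₀) (sum h₁) (sum (h ∘ extra)) ⟩
    sum h₀ + sum h₁ + sum (h ∘ extra)
      ≈⟨ +-congʳ (sum-+ h₀ h₁) ⟨
    sum (λ k → h₀ k + h₁ k) + sum (h ∘ extra)
      ≈⟨ +-congʳ (sum-cong swap) ⟩
    sum (λ k → h (selected k) + h (unselected k)) + sum (h ∘ extra)
      ≈⟨ +-congʳ (sum-+ (h ∘ selected) (h ∘ unselected)) ⟩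
    sum (h ∘ selected) + sum (h ∘ unselected) + sum (h ∘ extra) ∎
    where
    h₀ h₁ : Fin n → ℝ
    h₀ k = h (kindAt b (zero , k))
    h₁ k = h (kindAt b (suc zero , k))
    swap : ∀ k → h₀ k + h₁ k ≈ h (selected k) + h (unselected k)
    swap k with b k
    ... | true  = refl
    ... | false = +-comm _ _

  combination : ∀ {n} → ℝ → ℝ → Point n → Point n → Point n
  combination s t p q = record
    { y = λ i → s * y p i + t * y q i
    ; x = λ i j → s * x p i j + t * x q i j
    }

  sum-combination : ∀ {k} s t (a u v : Fin k → ℝ) →
    sum (λ i → a i * (s * u i + t * v i)) ≈ s * sum (λ i → a i * u i) + t * sum (λ i → a i * v i)
  sum-combination s t a u v = begin
    sum (λ i → a i * (s * u i + t * v i))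
      ≈⟨ sum-cong (λ i → solve 5 (λ a s u t v → a :* (s :* u :+ t :* v) := s :* (a :* u) :+ t :* (a :* v))
                           refl (a i) s (u i) t (v i)) ⟩
    sum (λ i → s * (a i * u i) + t * (a i * v i))
      ≈⟨ sum-+ (λ i → s * (a i * u i)) (λ i → t * (a i * v i)) ⟩
    sum (λ i → s * (a i * u i)) + sum (λ i → t * (a i * v i))
      ≈⟨ +-cong (*-sum s (λ i → a i * u i)) (*-sum t (λ i → a i * v i)) ⟨
    s * sum (λ i → a i * u i) + t * sum (λ i → a i * v i) ∎

  linear-combination : ∀ {n} s t f c (p q : Point n) →
    linear f c (combination s t p q) ≈ s * linear f c p + t * linear f c q
  linear-combination {n} s t f c p q = begin
    linear f c (combination s t p q)
      ≈⟨ +-cong (sum-combination s t f (y p) (y q))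
           (trans (sum-cong (λ i → sum-combination s t (c i) (x p i) (x q i)))
             (trans (sum-+ (λ i → s * X p i) (λ i → t * X q i))
               (sym (+-cong (*-sum s (X p)) (*-sum t (X q)))))) ⟩
    (s * Y p + t * Y q) + (s * sum (X p) + t * sum (X q))
      ≈⟨ solve 6 (λ s t a b c d → (s :* a :+ t :* b) :+ (s :* c :+ t :* d) :=
                                  s :* (a :+ c) :+ t :* (b :+ d))
           refl s t (Y p) (Y q) (sum (X p)) (sum (X q)) ⟩
    s * linear f c p + t * linear f c q ∎
    where
    Y : Point n → ℝ
    Y p = sum (λ i → f i * y p i)
    X : Point n → Fin (#fac n) → ℝ
    X p i = sum (λ j → c i j * x p i j)

  affine-combination : ∀ {n} {s t} → s + t ≈ 1# → ∀ π (p q : Point n) →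
    affine π (combination s t p q) ≈ s * affine π p + t * affine π q
  affine-combination {s = s} {t} s+t≈1 π p q = trans
    (+-congʳ (linear-combination s t α β p q))
    (by-relation (- γ) s+t≈1
      (solve 5 (λ s t a b g → s :* a :+ t :* b :+ g :=
                  (s :* (a :+ g) :+ t :* (b :+ g)) :+ (:- g) :* ((s :+ t) :- con (+ 1)))
        refl s t (linear α β p) (linear α β q) γ))
    where open Constraint π

  infix 4 _≋_
  _≋_ : ∀ {n} → Point n → Point n → Set
  p ≋ q = (∀ i → y p i ≈ y q i) × (∀ i j → x p i j ≈ x q i j)

  linear-cong : ∀ {n} f c (p q : Point n) → p ≋ q → linear f c p ≈ linear f c q
  linear-cong f c p q (y≈ , x≈) = +-cong (sum-cong (λ i → *-congˡ {f i} (y≈ i)))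
    (sum-cong (λ i → sum-cong (λ j → *-congˡ {c i j} (x≈ i j))))

  -- The linear part sees only the coordinatewise sum of two points, and both sides carry the
  -- constant `γ` twice.
  affine-exchange : ∀ {n} π {p q p′ q′ : Point n} →
    combination 1# 1# p q ≋ combination 1# 1# p′ q′ →
    affine π p + affine π q ≈ affine π p′ + affine π q′
  affine-exchange {n} π {p} {q} {p′} {q′} eq = begin
    affine π p + affine π q                      ≈⟨ split p q ⟩
    linear α β (combination 1# 1# p q) + (γ + γ)      ≈⟨ +-congʳ (linear-cong {n} α β (combination 1# 1# p q) (combination 1# 1# p′ q′) eq) ⟩
    linear α β (combination 1# 1# p′ q′) + (γ + γ)    ≈⟨ split p′ q′ ⟨
    affine π p′ + affine π q′                    ∎
    where
    open Constraint π
    split : ∀ p q → affine π p + affine π q ≈ linear α β (combination 1# 1# p q) + (γ + γ)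
    split p q = trans
      (solve 3 (λ a b g → (a :+ g) :+ (b :+ g) := (con (+ 1) :* a :+ con (+ 1) :* b) :+ (g :+ g))
        refl (linear α β p) (linear α β q) γ)
      (+-congʳ (sym (linear-combination 1# 1# α β p q)))

  feasible⇒hull : ∀ {n U} p → MixedIntegerFeasible n U p → CFLPolytope n U p
  feasible⇒hull p feasible = record
    { k      = 1
    ; weight = λ _ → 1#
    ; vertex = λ _ → p
    ; ∈S     = λ _ → feasible
    ; nonNeg = λ _ → 0≤1
    ; total  = +-identityʳ 1#
    ; y-comb = λ i → unit (y p i)
    ; x-comb = λ i j → unit (x p i j)
    }
    where
    unit : ∀ v → v ≈ 1# * v + 0#
    unit v = solve 1 (λ v → v := con (+ 1) :* v :+ con (+ 0)) refl v

  -- Numerical parameters of an instance.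

  -- The reciprocals `ν`, `τ` and `δ` are variables with defining equations, so that the ring solver
  -- can treat them polynomially.
  record Parameters (n : ℕ) (U : ℝ) : Set where
    N : ℝ
    N = fromℕ n
    M : ℝ
    M = fromℕ (#cli n)
    field
      ε ν τ δ  : ℝ
      1≤n      : 1 ℕ.≤ n
      0≤ε      : 0# ≤ ε
      ε≉0      : ¬ ε ≈ 0#
      capacity : M - N * U ≈ ε
      small    : (N * N * N + N + 1#) * ε ≤ 1#
      Nν≈1     : N * ν ≈ 1#
      0≤ν      : 0# ≤ ν
      τ[N²+1]≈1 : τ * (N * N + 1#) ≈ 1#
      0≤τ      : 0# ≤ τ
      δ[N+N²]≈1 : δ * (N + N * N) ≈ 1#
      0≤δ      : 0# ≤ δ

  module Instance {n : ℕ} {U : ℝ} (params : Parameters n U) where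

    open Parameters params

    -- `g` is the fraction of each client that one selected facility takes when all `n` of them
    -- together serve `1 - ε` of it. `κ` is the amount by which a repaired vertex relieves one
    -- selected facility. `μ` is the fraction given to an open extra facility, namely `κ` plus the
    -- shortfall `ε`.
    g κ μ : ℝ
    g = (1# - ε) * ν
    κ = N * N * ε
    μ = κ + ε

    1≤N : 1# ≤ N
    1≤N = 1≤fromℕ 1≤n

    0≤N : 0# ≤ N
    0≤N = fromℕ-nonNeg n

    0≤κ : 0# ≤ κ
    0≤κ = *-nonNeg (*-nonNeg 0≤N 0≤N) 0≤ε

    κ≤μ : κ ≤ μ
    κ≤μ = x≤x+nonNeg 0≤ε

    0≤μ : 0# ≤ μ
    0≤μ = ≤-trans 0≤κ κ≤μ

    ε≤μ : ε ≤ μ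
    ε≤μ = ≤-gap 0≤κ (+-comm κ ε)

    -- The slack is `ν` times the slack of `small`: this is where `ε` has to be tiny, so that one
    -- extra facility has room for `μ`.
    μ≤g : μ ≤ g
    μ≤g = ≤-gap (*-nonNeg 0≤ν (x≤y⇒0≤y-x small))
      (sym (by-relation (- (N * N * ε + ε)) Nν≈1
        (solve 3 (λ N e v →
            (N :* N :* e :+ e) :+ v :* (con (+ 1) :- (N :* N :* N :+ N :+ con (+ 1)) :* e) :=
            (con (+ 1) :- e) :* v :+ (:- (N :* N :* e :+ e)) :* (N :* v :- con (+ 1)))
          refl N ε ν)))

    g≤1 : g ≤ 1#
    g≤1 = ≤-gap (+-nonNeg (*-nonNeg (x≤y⇒0≤y-x 1≤N) 0≤ν) (*-nonNeg 0≤ε 0≤ν))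
      (sym (by-relation 1# Nν≈1
        (solve 3 (λ N e v →
            (con (+ 1) :- e) :* v :+ ((N :- con (+ 1)) :* v :+ e :* v) :=
            con (+ 1) :+ con (+ 1) :* (N :* v :- con (+ 1)))
          refl N ε ν)))

    Ng≈1-ε : N * g ≈ 1# - ε
    Ng≈1-ε = by-relation (1# - ε) Nν≈1
      (solve 3 (λ N e v → N :* ((con (+ 1) :- e) :* v) :=
                 con (+ 1) :- e :+ (con (+ 1) :- e) :* (N :* v :- con (+ 1)))
        refl N ε ν)

    -- Since `N * U` is `M - ε`, the slack is `(M - 1#) * ε * ν`: all clients are served alike, and
    -- giving up `ε` of every client gives up more than the missing `ε`.
    Mg≤U : M * g ≤ U
    Mg≤U = ≤-gap (*-nonNeg (*-nonNeg (x≤y⇒0≤y-x 1≤M) 0≤ε) 0≤ν)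
      (trans (by-relation (- U) Nν≈1
                (solve 3 (λ N U v → U := N :* U :* v :+ (:- U) :* (N :* v :- con (+ 1))) refl N U ν))
             (sym (by-relation ν capacity
                (solve 5 (λ M N U e v →
                    M :* ((con (+ 1) :- e) :* v) :+ ((M :- con (+ 1)) :* e :* v) :=
                    N :* U :* v :+ v :* ((M :- N :* U) :- e))
                  refl M N U ε ν))))
      where
      1≤M : 1# ≤ M
      1≤M = 1≤fromℕ (ℕ.m≤n+m 1 (n ℕ.^ 4))

    0≤g : 0# ≤ g
    0≤g = ≤-trans 0≤μ μ≤g

    κ≤g : κ ≤ g
    κ≤g = ≤-trans κ≤μ μ≤g

    Nε≤g : N * ε ≤ g
    Nε≤g = ≤-trans (≤-gap (*-nonNeg (*-nonNeg 0≤N (x≤y⇒0≤y-x 1≤N)) 0≤ε)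
      (solve 2 (λ N e → N :* N :* e := N :* e :+ N :* (N :- con (+ 1)) :* e) refl N ε)) κ≤g

    0≤U : 0# ≤ U
    0≤U = ≤-trans (*-nonNeg (fromℕ-nonNeg (#cli n)) 0≤g) Mg≤U

    -- Vertices and their feasibility.

    openBase : Kind n → Bool
    openBase = alloc (λ _ → true) (λ _ → true) (λ _ → false)

    openWith : Fin n → Kind n → Bool
    openWith k = alloc (λ _ → true) (λ _ → true) (λ l → does (l Fin.≟ k))

    -- Every client is fully assigned, but `M * ν` exceeds `U` by `ε * ν` at each selected facility.
    baseLoad : Kind n → ℝ
    baseLoad = alloc (λ _ → ν) (λ _ → 0#) (λ _ → 0#)

    -- The selected facilities stay `N * ε` below `g`, which offsets `N * N` copies of the excess
    -- `ν - g = ε * ν` of `baseLoad`. The extra facility takes the `N * N * ε` given up and the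
    -- shortfall `ε`.
    loadWith : Fin n → Kind n → ℝ
    loadWith k = alloc (λ _ → g - N * ε) (λ _ → 0#) (single k μ)

    -- The repaired loads use the unselected facility of slot k₀ and relieve the
    -- selected one in exchange.

    baseLoad′ : Fin n → Kind n → ℝ
    baseLoad′ k₀ = alloc (λ _ → g) (single k₀ ε) (λ _ → 0#)

    loadWith′ : Fin n → Fin n → Kind n → ℝ
    loadWith′ k₀ k = alloc (λ l → g + single k₀ (- κ) l) (λ _ → 0#) (single k μ)

    module Vertex (b : Fin n → Bool) (o : Kind n → Bool) (load : Kind n → ℝ) =
      AtVertex {n} (o ∘ kind b) (λ i _ → load (kind b i))

    baseVertex : (Fin n → Bool) → Point n
    baseVertex b = Vertex.point b openBase baseLoad

    vertexWith : (Fin n → Bool) → Fin n → Point n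
    vertexWith b k = Vertex.point b (openWith k) (loadWith k)

    baseVertex′ : (Fin n → Bool) → Fin n → Point n
    baseVertex′ b k₀ = Vertex.point b openBase (baseLoad′ k₀)

    vertexWith′ : (Fin n → Bool) → Fin n → Fin n → Point n
    vertexWith′ b k₀ k = Vertex.point b (openWith k) (loadWith′ k₀ k)

    -- Loads do not depend on the client, so this one bound yields both the opening constraint, by
    -- `g≤1`, and the capacity constraint, by `Mg≤U`.
    WithinCapacity : Bool → ℝ → Set
    WithinCapacity o v = 0# ≤ v × v ≤ ind o * g

    within-open : ∀ {v} → 0# ≤ v → v ≤ g → WithinCapacity true v
    within-open 0≤v v≤g = 0≤v , ≤-respʳ-≈ (sym (*-identityˡ g)) v≤g

    within-closed : WithinCapacity false 0#
    within-closed = ≤-refl , ≤-≈ (sym (zeroˡ g))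

    feasible : ∀ b o load → (∀ c → WithinCapacity (o c) (load c)) →
      sum (load ∘ selected) + sum (load ∘ unselected) + sum (load ∘ extra) ≈ 1# →
      MixedIntegerFeasible n U (Vertex.point b o load)
    feasible b o load within unit-load = record
      { binary   = λ i → binary-ind (o (kind b i))
      ; box      = λ i j → proj₁ (within (kind b i)) ,
                           ≤-trans (load≤open (kind b i)) (ind≤1 (o (kind b i)))
      ; assigned = λ j → trans (sum-kind b load) unit-load
      ; opened   = λ i j → load≤open (kind b i)
      ; capacity = λ i → ≤-trans (≤-≈ (sum-const (#cli n))) (scaled (kind b i))
      }
      where
      binary-ind : ∀ c → ind c ≈ 0# ⊎ ind c ≈ 1#
      binary-ind true  = inj₂ refl
      binary-ind false = inj₁ refl
      ind≤1 : ∀ c → ind c ≤ 1#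
      ind≤1 true  = ≤-refl
      ind≤1 false = 0≤1
      load≤open : ∀ c → load c ≤ ind (o c)
      load≤open c = ≤-trans (proj₂ (within c))
        (≤-respʳ-≈ (*-identityʳ _) (*-monoˡ-≤ (ind-nonNeg (o c)) g≤1))
      scaled : ∀ c → M * load c ≤ U * ind (o c)
      scaled c = ≤-trans (*-monoˡ-≤ (fromℕ-nonNeg (#cli n)) (proj₂ (within c)))
        (≤-resp-≈ (solve 3 (λ i m g → i :* (m :* g) := m :* (i :* g)) refl (ind (o c)) M g)
                  (*-comm _ _)
                  (*-monoˡ-≤ (ind-nonNeg (o c)) Mg≤U))

    sum-0 : sum {n} (λ _ → 0#) ≈ 0#
    sum-0 = sum-zero {n} {λ _ → 0#} (λ _ → refl)

    within-extra : ∀ k l → WithinCapacity (openWith k (extra l)) (single k μ l)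
    within-extra k l with does (l Fin.≟ k)
    ... | true  = within-open 0≤μ μ≤g
    ... | false = within-closed

    vertexWith-feasible : ∀ b k → MixedIntegerFeasible n U (vertexWith b k)
    vertexWith-feasible b k = feasible b (openWith k) (loadWith k) within unit-load
      where
      within : ∀ c → WithinCapacity (openWith k c) (loadWith k c)
      within (selected l)   = within-open (x≤y⇒0≤y-x Nε≤g)
        (≤-gap (*-nonNeg 0≤N 0≤ε) (solve 2 (λ g e → g := (g :- e) :+ e) refl g (N * ε)))
      within (unselected l) = within-open ≤-refl 0≤g
      within (extra l)      = within-extra k l
      unit-load : sum {n} (λ _ → g - N * ε) + sum {n} (λ _ → 0#) + sum (single k μ) ≈ 1#
      unit-load = begin
        sum {n} (λ _ → g - N * ε) + sum {n} (λ _ → 0#) + sum (single k μ)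
          ≈⟨ +-cong (+-cong (sum-const n) sum-0) (sum-single k μ) ⟩
        N * (g - N * ε) + 0# + μ
          ≈⟨ by-relation 1# Ng≈1-ε
               (solve 3 (λ N g e → N :* (g :- N :* e) :+ con (+ 0) :+ (N :* N :* e :+ e) :=
                           con (+ 1) :+ con (+ 1) :* (N :* g :- (con (+ 1) :- e)))
                 refl N g ε) ⟩
        1# ∎

    baseVertex′-feasible : ∀ b k₀ → MixedIntegerFeasible n U (baseVertex′ b k₀)
    baseVertex′-feasible b k₀ = feasible b openBase (baseLoad′ k₀) within unit-load
      where
      within : ∀ c → WithinCapacity (openBase c) (baseLoad′ k₀ c)
      within (selected l)   = within-open 0≤g ≤-refl
      within (unselected l) with does (l Fin.≟ k₀)
      ... | true  = within-open 0≤ε (≤-trans ε≤μ μ≤g)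
      ... | false = within-open ≤-refl 0≤g
      within (extra l)      = within-closed
      unit-load : sum {n} (λ _ → g) + sum (single k₀ ε) + sum {n} (λ _ → 0#) ≈ 1#
      unit-load = begin
        sum {n} (λ _ → g) + sum (single k₀ ε) + sum {n} (λ _ → 0#)
          ≈⟨ +-cong (+-cong (sum-const n) (sum-single k₀ ε)) sum-0 ⟩
        N * g + ε + 0#
          ≈⟨ by-relation 1# Ng≈1-ε
               (solve 3 (λ N g e → N :* g :+ e :+ con (+ 0) :=
                           con (+ 1) :+ con (+ 1) :* (N :* g :- (con (+ 1) :- e)))
                 refl N g ε) ⟩
        1# ∎

    vertexWith′-feasible : ∀ b k₀ k → MixedIntegerFeasible n U (vertexWith′ b k₀ k)
    vertexWith′-feasible b k₀ k = feasible b (openWith k) (loadWith′ k₀ k) within unit-load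
      where
      within : ∀ c → WithinCapacity (openWith k c) (loadWith′ k₀ k c)
      within (selected l) with does (l Fin.≟ k₀)
      ... | true  = within-open (x≤y⇒0≤y-x κ≤g)
                      (≤-gap 0≤κ (solve 2 (λ g k → g := (g :- k) :+ k) refl g κ))
      ... | false = within-open (+-nonNeg 0≤g ≤-refl) (≤-≈ (+-identityʳ g))
      within (unselected l) = within-open ≤-refl 0≤g
      within (extra l)      = within-extra k l
      unit-load : sum (λ l → g + single k₀ (- κ) l) + sum {n} (λ _ → 0#) + sum (single k μ) ≈ 1#
      unit-load = begin
        sum (λ l → g + single k₀ (- κ) l) + sum {n} (λ _ → 0#) + sum (single k μ)
          ≈⟨ +-cong (+-cong (trans (sum-+ (λ _ → g) (single k₀ (- κ)))
                                   (+-cong (sum-const n) (sum-single k₀ (- κ))))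
                            sum-0)
                    (sum-single k μ) ⟩
        (N * g - κ) + 0# + μ
          ≈⟨ by-relation 1# Ng≈1-ε
               (solve 4 (λ N g e k → (N :* g :- k) :+ con (+ 0) :+ (k :+ e) :=
                           con (+ 1) :+ con (+ 1) :* (N :* g :- (con (+ 1) :- e)))
                 refl N g ε κ) ⟩
        1# ∎

    -- Test points and the exchange argument.

    -- `s` and `τ` are in the ratio `N² : 1`, in which the excess of `baseLoad` over `g` and the
    -- deficit of `loadWith` below it cancel on the selected facilities.
    s : ℝ
    s = τ * (N * N)

    s+τ≈1 : s + τ ≈ 1#
    s+τ≈1 = trans (solve 2 (λ t r → t :* r :+ t := t :* (r :+ con (+ 1))) refl τ (N * N)) τ[N²+1]≈1

    testPoint : (Fin n → Bool) → Fin n → Point n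
    testPoint b k = combination s τ (baseVertex b) (vertexWith b k)

    repairedPoint : (Fin n → Bool) → Fin n → Fin n → Point n
    repairedPoint b k₀ k = combination s τ (baseVertex′ b k₀) (vertexWith′ b k₀ k)

    shift : Fin n → Kind n → ℝ
    shift k₀ = alloc (single k₀ (- (τ * κ))) (single k₀ (τ * κ)) (λ _ → 0#)

    -- By that cancellation all slots other than `k₀` agree. In slot `k₀` the repair hands `s * ε`,
    -- which is `τ * κ`, to the unselected facility and takes as much from the selected one.
    repaired-load : ∀ k₀ k c → s * baseLoad′ k₀ c + τ * loadWith′ k₀ k c ≈
                               (s * baseLoad c + τ * loadWith k c) + shift k₀ c
    repaired-load k₀ k (selected l) with does (l Fin.≟ k₀)
    ... | true  = by-relation (- (τ * (N * ε))) Nν≈1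
      (solve 5 (λ t N e v g →
          t :* (N :* N) :* ((con (+ 1) :- e) :* v) :+ t :* (g :- N :* N :* e) :=
          ((t :* (N :* N) :* v :+ t :* (g :- N :* e)) :+ (:- (t :* (N :* N :* e)))) :+
          (:- (t :* (N :* e))) :* (N :* v :- con (+ 1)))
        refl τ N ε ν g)
    ... | false = by-relation (- (τ * (N * ε))) Nν≈1
      (solve 5 (λ t N e v g →
          t :* (N :* N) :* ((con (+ 1) :- e) :* v) :+ t :* (g :+ con (+ 0)) :=
          ((t :* (N :* N) :* v :+ t :* (g :- N :* e)) :+ con (+ 0)) :+
          (:- (t :* (N :* e))) :* (N :* v :- con (+ 1)))
        refl τ N ε ν g)
    repaired-load k₀ k (unselected l) with does (l Fin.≟ k₀)
    ... | true  = solve 3 (λ t N e →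
          t :* (N :* N) :* e :+ t :* con (+ 0) :=
          (t :* (N :* N) :* con (+ 0) :+ t :* con (+ 0)) :+ t :* (N :* N :* e))
        refl τ N ε
    ... | false = sym (+-identityʳ _)
    repaired-load k₀ k (extra l) = sym (+-identityʳ _)

    -- In slot `k₀` the facility selected by one vector is the one left unselected by the other, so
    -- the two transfers run in opposite directions; in all other slots both vanish.
    shifts-cancel : ∀ b b′ k₀ → b k₀ ≢ b′ k₀ → ∀ i → shift k₀ (kind b i) + shift k₀ (kind b′ i) ≈ 0#
    shifts-cancel b b′ k₀ differ i = cancel (Fin.remQuot {3} n i)
      where
      opposite : ∀ v l → single k₀ (- v) l + single k₀ v l ≈ 0#
      opposite v l with does (l Fin.≟ k₀)
      ... | true  = -‿inverseˡ v
      ... | false = +-identityˡ 0#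
      single-≢ : ∀ v {l} → l ≢ k₀ → single k₀ v l ≈ 0#
      single-≢ v {l} l≢k₀ with l Fin.≟ k₀
      ... | yes l≡k₀ = contradiction l≡k₀ l≢k₀
      ... | no  _    = refl
      -- `K` gives the kind of one facility of slot `l` as a function of the bit there; equal bits
      -- occur only for `l ≢ k₀`.
      pair : (K : Bool → Kind n) → ∀ {l} → shift k₀ (K true) + shift k₀ (K false) ≈ 0# →
             (∀ c → l ≢ k₀ → shift k₀ (K c) ≈ 0#) →
             ∀ c c′ → (l ≡ k₀ → c ≢ c′) → shift k₀ (K c) + shift k₀ (K c′) ≈ 0#
      pair K opp far true  true  c≢c′ = trans (+-cong (far true l≢) (far true l≢)) (+-identityˡ 0#)
        where l≢ = λ eq → c≢c′ eq ≡.refl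
      pair K opp far false false c≢c′ = trans (+-cong (far false l≢) (far false l≢)) (+-identityˡ 0#)
        where l≢ = λ eq → c≢c′ eq ≡.refl
      pair K opp far true  false c≢c′ = opp
      pair K opp far false true  c≢c′ = trans (+-comm _ _) opp
      cancel : ∀ al → shift k₀ (kindAt b al) + shift k₀ (kindAt b′ al) ≈ 0#
      cancel (zero , l) =
        pair (λ c → if c then selected l else unselected l) {l} (opposite (τ * κ) l)
          (λ { true → single-≢ _ ; false → single-≢ _ }) (b l) (b′ l) (λ { ≡.refl → differ })
      cancel (suc zero , l) =
        pair (λ c → if c then unselected l else selected l) {l} (trans (+-comm _ _) (opposite (τ * κ) l))
          (λ { true → single-≢ _ ; false → single-≢ _ }) (b l) (b′ l) (λ { ≡.refl → differ })
      cancel (suc (suc zero) , l) = +-identityˡ 0#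

    Valid : Constraint n → Set
    Valid π = ∀ p → MixedIntegerFeasible n U p → affine π p ≤ 0#

    test-exchange : ∀ b b′ k₀ → b k₀ ≢ b′ k₀ → ∀ k k′ →
      combination 1# 1# (testPoint b k) (testPoint b′ k′) ≋
      combination 1# 1# (repairedPoint b k₀ k) (repairedPoint b′ k₀ k′)
    -- The repair leaves the sets of open facilities alone, so the opening coordinates agree
    -- definitionally.
    test-exchange b b′ k₀ differ k k′ = (λ i → refl) , λ i j → sym (begin
      1# * x (repairedPoint b k₀ k) i j + 1# * x (repairedPoint b′ k₀ k′) i j
        ≈⟨ +-cong (*-congˡ (repaired-load k₀ k (kind b i))) (*-congˡ (repaired-load k₀ k′ (kind b′ i))) ⟩
      1# * (x (testPoint b k) i j + shift k₀ (kind b i)) +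
      1# * (x (testPoint b′ k′) i j + shift k₀ (kind b′ i))
        ≈⟨ by-relation 1# (shifts-cancel b b′ k₀ differ i)
             (solve 4 (λ t t′ s s′ →
                 con (+ 1) :* (t :+ s) :+ con (+ 1) :* (t′ :+ s′) :=
                 (con (+ 1) :* t :+ con (+ 1) :* t′) :+ con (+ 1) :* ((s :+ s′) :- con (+ 0)))
               refl (x (testPoint b k) i j) (x (testPoint b′ k′) i j)
                    (shift k₀ (kind b i)) (shift k₀ (kind b′ i))) ⟩
      1# * x (testPoint b k) i j + 1# * x (testPoint b′ k′) i j ∎)

    repairedPoint-valid : ∀ {π} → Valid π → ∀ b k₀ k → affine π (repairedPoint b k₀ k) ≤ 0#
    repairedPoint-valid {π} valid b k₀ k = ≤-respˡ-≈
      (sym (affine-combination s+τ≈1 π (baseVertex′ b k₀) (vertexWith′ b k₀ k)))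
      (+-nonPos (*-nonPos (*-nonNeg 0≤τ (*-nonNeg 0≤N 0≤N)) (valid _ (baseVertex′-feasible b k₀)))
                (*-nonPos 0≤τ (valid _ (vertexWith′-feasible b k₀ k))))

    -- If `b` and `b′` differed at `k₀`, the values of `π` at the two test points would have the
    -- same sum as at two repaired points. These are convex combinations of feasible vertices, so
    -- `π` cannot be positive at both test points.
    violators-agree : ∀ {π} → Valid π → ∀ b b′ k k′ →
      ¬ affine π (testPoint b k) ≤ 0# → ¬ affine π (testPoint b′ k′) ≤ 0# → ∀ k₀ → ¬ b k₀ ≢ b′ k₀
    violators-agree {π} valid b b′ k k′ violated violated′ k₀ differ =
      violated (≤-trans (x≤x+nonNeg (≰⇒≥ violated′))
        (≤-respˡ-≈ (sym (affine-exchange π {testPoint b k} {testPoint b′ k′} (test-exchange b b′ k₀ differ k k′)))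
          (+-nonPos (repairedPoint-valid {π} valid b k₀ k) (repairedPoint-valid {π} valid b′ k₀ k′))))

    -- The pseudo-distribution and the lifted constraints.

    -- `ρ` and `δ` have the ratio of `s` and `τ`, so the base vertex together with any single vertex
    -- of an extra facility is a multiple of a test point.
    ρ : ℝ
    ρ = δ * (N * N)

    weight : Fin (suc n) → ℝ
    weight zero    = ρ
    weight (suc k) = δ

    vertexLift : (Fin n → Bool) → Fin (suc n) → LiftedPoint n
    vertexLift b zero    = Vertex.lifted b openBase baseLoad
    vertexLift b (suc k) = Vertex.lifted b (openWith k) (loadWith k)

    liftedPoint : (Fin n → Bool) → LiftedPoint n
    liftedPoint b = mixture weight (vertexLift b)

    projection : (Fin n → Bool) → Point n
    projection b = record
      { y = λ i → yˢ (liftedPoint b) ⁅ i ⁆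
      ; x = vˢ (liftedPoint b) ∅
      }

    lifted↦projection : ∀ b → ProjectsTo (liftedPoint b) (projection b)
    lifted↦projection b = record
      { y-empty     = trans
          (+-cong (*-congˡ (χ-∅ (openBase ∘ kind b)))
            (trans (sum-cong {n} {λ k → δ * χ (openWith k ∘ kind b) ∅} {λ _ → δ * 1#}
                     (λ k → *-congˡ (χ-∅ (openWith k ∘ kind b))))
                   (sum-const n)))
          (trans (solve 3 (λ d R N → d :* R :* con (+ 1) :+ N :* (d :* con (+ 1)) := d :* (N :+ R))
                   refl δ (N * N) N)
                 δ[N+N²]≈1)
      ; y-singleton = λ i → refl
      ; v-empty     = λ i j → refl
      }

    extra∉ : ∀ {t} (A W : Subset (#fac n)) → t ℕ.< n → ∣ A ∣ ℕ.≤ t → W ⊆ A → ∃[ k ] extraFacility k ∉ W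
    extra∉ A W t<n ∣A∣≤t W⊆A = Fin.¬∀⟶∃¬ n _ (λ k → extraFacility k ∈? W) λ extras∈W →
      ℕ.<⇒≱ t<n (ℕ.≤-trans (injection⇒≤∣∣ W extraFacility extraFacility-injective extras∈W)
                   (ℕ.≤-trans (p⊆q⇒∣p∣≤∣q∣ W⊆A) ∣A∣≤t))

    -- Opening extra facility `k` raises only that coordinate. A factor `y_i` cannot drop, and the
    -- only factor `1 - y_i` that could drop is absent because its facility is outside `W`.
    kept-with : ∀ b (A W : Subset (#fac n)) {k} → extraFacility k ∉ W →
      (∀ i → T (Vertex.factor b openBase baseLoad A W i)) →
      ∀ i → T (Vertex.factor b (openWith k) (loadWith k) A W i)
    kept-with b A W {k} k∉W kept i with i ∈? W | i ∈? A | kept i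
    ... | yes i∈W | _     | closed = stays-closed (kind b i) ≡.refl closed
      where
      stays-closed : ∀ c → kind b i ≡ c → T (not (openBase c)) → T (not (openWith k c))
      stays-closed (extra l) eq _ with l Fin.≟ k
      ... | yes ≡.refl = contradiction (≡.subst (_∈ W) (kind-extra⁻ b i eq) i∈W) k∉W
      ... | no  _      = _
    ... | no _    | yes _ | opened = stays-open (kind b i) opened
      where
      stays-open : ∀ c → T (openBase c) → T (openWith k c)
      stays-open (selected _)   _ = _
      stays-open (unselected _) _ = _
    ... | no _    | no _  | _      = _

    survives : ∀ {t π} → t ℕ.< n → Valid π → ∀ b → (∀ k → affine π (testPoint b k) ≤ 0#) →
      ∀ A W → ∣ A ∣ ℕ.≤ t → W ⊆ A → linearized (liftedPoint b) (lift A W π) ≤ 0#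
    survives {t} {π} t<n valid b satisfied A W ∣A∣≤t W⊆A = ≤-respˡ-≈
      (sym (linearized-mixture weight (vertexLift b) (lift A W π)))
      (cases (Vertex.kept? b openBase baseLoad A W))
      where
      L : Fin (suc n) → ℝ
      L l = linearized (vertexLift b l) (lift A W π)
      L-with≤0 : ∀ k → L (suc k) ≤ 0#
      L-with≤0 k with Vertex.lift-dichotomy b (openWith k) (loadWith k) A W π
      ... | inj₁ eq = ≤-respˡ-≈ (sym eq) (valid _ (vertexWith-feasible b k))
      ... | inj₂ eq = ≤-≈ eq
      cases : Dec (∀ i → T (Vertex.factor b openBase baseLoad A W i)) →
              ρ * L zero + sum (λ k → δ * L (suc k)) ≤ 0#
      cases (no ¬kept) with Fin.¬∀⟶∃¬ _ _ (λ i → T? (Vertex.factor b openBase baseLoad A W i)) ¬kept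
      -- With the base vertex killed, only feasible vertices contribute.
      ... | i , killed = +-nonPos
        (≤-≈ (trans (*-congˡ (Vertex.lift-killed b openBase baseLoad A W π {i} killed)) (zeroʳ ρ)))
        (sum-nonPos (λ k → *-nonPos 0≤δ (L-with≤0 k)))
      cases (yes kept) with extra∉ A W t<n ∣A∣≤t W⊆A
      -- With the base vertex kept, vertex `k` is kept too; together they form `δ * (N * N + 1#)`
      -- times the test point of `k`, and the other vertices are feasible.
      ... | k , k∉W = sum-nonPos-at k (λ l → *-nonPos 0≤δ (L-with≤0 l))
        (≤-respˡ-≈ rescale (*-nonPos (*-nonNeg 0≤δ (+-nonNeg (*-nonNeg 0≤N 0≤N) 0≤1)) (satisfied k)))
        where
        a₀ a₁ : ℝ
        a₀ = affine π (baseVertex b)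
        a₁ = affine π (vertexWith b k)
        rescale : δ * (N * N + 1#) * affine π (testPoint b k) ≈ ρ * L zero + δ * L (suc k)
        rescale = begin
          δ * (N * N + 1#) * affine π (testPoint b k)
            ≈⟨ *-congˡ (affine-combination s+τ≈1 π (baseVertex b) (vertexWith b k)) ⟩
          δ * (N * N + 1#) * (s * a₀ + τ * a₁)
            ≈⟨ by-relation (δ * (N * N * a₀ + a₁)) τ[N²+1]≈1
                 (solve 5 (λ d t R a₀ a₁ →
                     d :* (R :+ con (+ 1)) :* (t :* R :* a₀ :+ t :* a₁) :=
                     (d :* R :* a₀ :+ d :* a₁) :+
                     (d :* (R :* a₀ :+ a₁)) :* (t :* (R :+ con (+ 1)) :- con (+ 1)))
                   refl δ τ (N * N) a₀ a₁) ⟩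
          ρ * a₀ + δ * a₁
            ≈⟨ +-cong (*-congˡ (Vertex.lift-kept b openBase baseLoad A W π kept))
                      (*-congˡ (Vertex.lift-kept b (openWith k) (loadWith k) A W π (kept-with b A W k∉W kept))) ⟨
          ρ * L zero + δ * L (suc k) ∎

    projection∈SA : ∀ {t} {D : Description n} → t ℕ.< n → All Valid D → ∀ b →
      (∀ k → All (λ π → affine π (testPoint b k) ≤ 0#) D) → SA t D (projection b)
    projection∈SA t<n valid b satisfied = liftedPoint b , lifted↦projection b ,
      All.tabulate (λ {π} π∈D → survives {π = π} t<n (All.lookup valid π∈D) b (λ k → All.lookup (satisfied k) π∈D))

    -- The objective, its integral optimum and its fractional cost.

    ℒ : ℝ
    ℒ = ε ⁻¹

    openingCost connectionCost : Kind n → ℝ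
    openingCost    = alloc (λ _ → 0#) (λ _ → 0#) (λ _ → 1#)
    connectionCost = alloc (λ _ → 0#) (λ _ → ℒ) (λ _ → 0#)

    objective : (Fin n → Bool) → Objective n
    objective b = record
      { f = λ i → openingCost (kind b i)
      ; c = λ i _ → connectionCost (kind b i)
      }

    0≤ℒ : 0# ≤ ℒ
    0≤ℒ = ⁻¹-nonNeg 0≤ε ε≉0

    openingCost-nonNeg : ∀ c → 0# ≤ openingCost c
    openingCost-nonNeg (selected _)   = ≤-refl
    openingCost-nonNeg (unselected _) = ≤-refl
    openingCost-nonNeg (extra _)      = 0≤1

    connectionCost-nonNeg : ∀ c → 0# ≤ connectionCost c
    connectionCost-nonNeg (selected _)   = ≤-refl
    connectionCost-nonNeg (unselected _) = 0≤ℒ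
    connectionCost-nonNeg (extra _)      = ≤-refl

    objective-admissible : ∀ b → Admissible (objective b)
    objective-admissible b = record
      { f-nonNeg = λ i → openingCost-nonNeg (kind b i)
      ; c-nonNeg = λ i j → connectionCost-nonNeg (kind b i)
      -- Distances do not depend on the client, so `c i j` equals the last summand `c i j′`.
      ; metric   = λ i i′ j j′ →
          ≤-gap (+-nonNeg (connectionCost-nonNeg (kind b i′)) (connectionCost-nonNeg (kind b i′)))
            (+-comm _ _)
      }

    -- The cost recast as an affine form, so that the linearization lemmas evaluate it at the
    -- mixture vertex by vertex.
    costConstraint : (Fin n → Bool) → Constraint n
    costConstraint b = record { α = Objective.f (objective b) ; β = Objective.c (objective b) ; γ = 0# }

    vertex-cost : ∀ b o load → (∀ c → connectionCost c * load c ≈ 0#) →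
      affine (costConstraint b) (Vertex.point b o load) ≈ sum (λ k → ind (o (extra k)))
    vertex-cost b o load unconnected = begin
      (sum (λ i → openingCost (kind b i) * ind (o (kind b i))) +
       sum (λ i → sum {#cli n} (λ _ → connectionCost (kind b i) * load (kind b i)))) + 0#
        ≈⟨ +-congʳ (+-cong (sum-kind b (λ c → openingCost c * ind (o c)))
             (sum-zero (λ i → sum-zero {#cli n} (λ _ → unconnected (kind b i))))) ⟩
      (sum (λ k → 0# * ind (o (selected k))) + sum (λ k → 0# * ind (o (unselected k))) +
       sum (λ k → 1# * ind (o (extra k))) + 0#) + 0#
        ≈⟨ trans (+-identityʳ _) (+-identityʳ _) ⟩
      sum (λ k → 0# * ind (o (selected k))) + sum (λ k → 0# * ind (o (unselected k))) +
      sum (λ k → 1# * ind (o (extra k)))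
        ≈⟨ +-cong (+-cong (sum-zero (λ k → zeroˡ (ind (o (selected k)))))
                          (sum-zero (λ k → zeroˡ (ind (o (unselected k))))))
                  (sum-cong (λ k → *-identityˡ (ind (o (extra k))))) ⟩
      0# + 0# + sum (λ k → ind (o (extra k)))
        ≈⟨ trans (+-congʳ (+-identityˡ 0#)) (+-identityˡ _) ⟩
      sum (λ k → ind (o (extra k))) ∎

    -- The base vertex costs nothing, and each of the `n` others costs 1 with weight `δ`. The value
    -- is `1 / (n + 1)`.
    projection-cost : ∀ b → cost (objective b) (projection b) ≈ N * δ
    projection-cost b = begin
      cost (objective b) (projection b)
        ≈⟨ +-identityʳ _ ⟨
      affine (costConstraint b) (projection b)
        ≈⟨ linearized-toPolynomial (lifted↦projection b) (costConstraint b) ⟨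
      linearized (liftedPoint b) (toPolynomial (costConstraint b))
        ≈⟨ linearized-mixture weight (vertexLift b) (toPolynomial (costConstraint b)) ⟩
      ρ * L zero + sum (λ k → δ * L (suc k))
        ≈⟨ +-cong (trans (*-congˡ base-cost) (zeroʳ ρ))
             (trans (sum-cong (λ k → trans (*-congˡ (with-cost k)) (*-identityʳ δ))) (sum-const n)) ⟩
      0# + N * δ
        ≈⟨ +-identityˡ _ ⟩
      N * δ ∎
      where
      L : Fin (suc n) → ℝ
      L l = linearized (vertexLift b l) (toPolynomial (costConstraint b))
      unconnected-base : ∀ c → connectionCost c * baseLoad c ≈ 0#
      unconnected-base (selected _)   = zeroˡ _
      unconnected-base (unselected _) = zeroʳ _
      unconnected-base (extra _)      = zeroˡ _
      unconnected-with : ∀ k c → connectionCost c * loadWith k c ≈ 0#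
      unconnected-with k (selected _)   = zeroˡ _
      unconnected-with k (unselected _) = zeroʳ _
      unconnected-with k (extra _)      = zeroˡ _
      base-cost : L zero ≈ 0#
      base-cost = trans
        (linearized-toPolynomial (Vertex.lifted↦point b openBase baseLoad) (costConstraint b))
        (trans (vertex-cost b openBase baseLoad unconnected-base) sum-0)
      with-cost : ∀ k → L (suc k) ≈ 1#
      with-cost k = trans
        (linearized-toPolynomial (Vertex.lifted↦point b (openWith k) (loadWith k)) (costConstraint b))
        (trans (vertex-cost b (openWith k) (loadWith k) (unconnected-with k)) (sum-single k 1#))

    open-nonNeg : ∀ {p} → MixedIntegerFeasible n U p → ∀ i → 0# ≤ y p i
    open-nonNeg feasible i =
      [ (λ y≈0 → ≤-≈ (sym y≈0)) , (λ y≈1 → ≤-respʳ-≈ (sym y≈1) 0≤1) ] (MixedIntegerFeasible.binary feasible i)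

    opening-nonNeg : ∀ b p → MixedIntegerFeasible n U p → ∀ i → 0# ≤ openingCost (kind b i) * y p i
    opening-nonNeg b p feasible i = *-nonNeg (openingCost-nonNeg (kind b i)) (open-nonNeg feasible i)

    connection-nonNeg : ∀ b p → MixedIntegerFeasible n U p →
      0# ≤ sum (λ i → sum (λ j → connectionCost (kind b i) * x p i j))
    connection-nonNeg b p feasible = sum-nonNeg (λ i → sum-nonNeg (λ j →
      *-nonNeg (connectionCost-nonNeg (kind b i)) (proj₁ (MixedIntegerFeasible.box feasible i j))))

    -- If no extra facility is open, the n selected ones leave demand ε to the
    -- unselected ones, at unit cost 1 / ε.
    integral-cost≥1 : ∀ b p → MixedIntegerFeasible n U p → 1# ≤ cost (objective b) p
    integral-cost≥1 b p feasible with Fin.any? (λ k → y p (extraFacility k) ≟ 1#)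
    ... | yes (k , yₖ≈1) = ≤-trans
      (≤-respˡ-≈ opening≈1 (term≤sum (opening-nonNeg b p feasible) (extraFacility k)))
      (x≤x+nonNeg (connection-nonNeg b p feasible))
      where
      opening≈1 : openingCost (kind b (extraFacility k)) * y p (extraFacility k) ≈ 1#
      opening≈1 = trans (*-cong (reflexive (≡.cong openingCost (kind-extra b k))) yₖ≈1) (*-identityˡ 1#)
    ... | no closed = ≤-trans 1≤C (≤-gap (sum-nonNeg (opening-nonNeg b p feasible)) (+-comm _ _))
      where
      open MixedIntegerFeasible feasible renaming (capacity to within)
      load C : Fin (#fac n) → ℝ
      load i = sum (x p i)
      C i    = sum (λ j → connectionCost (kind b i) * x p i j)
      isSelected : Kind n → ℝ
      isSelected = alloc (λ _ → 1#) (λ _ → 0#) (λ _ → 0#)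
      y≤1 : ∀ i → y p i ≤ 1#
      y≤1 i = [ (λ eq → ≤-respˡ-≈ (sym eq) 0≤1) , ≤-≈ ] (binary i)
      extra-closed : ∀ i k → kind b i ≡ extra k → y p i ≈ 0#
      extra-closed i k eq with kind-extra⁻ b i eq
      ... | ≡.refl = [ id , (λ yₖ≈1 → contradiction (k , yₖ≈1) closed) ] (binary i)
      C≈ : ∀ i → C i ≈ connectionCost (kind b i) * load i
      C≈ i = sym (*-sum (connectionCost (kind b i)) (x p i))
      -- A charging bound: selected load is limited by capacity, unselected load equals `ε` times
      -- its own cost, and closed extra facilities carry nothing.
      load≤ : ∀ i c → kind b i ≡ c → load i ≤ U * isSelected c + ε * (connectionCost c * load i)
      load≤ i (selected k) _ = ≤-trans (within i) (≤-trans (*-monoˡ-≤ 0≤U (y≤1 i))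
        (≤-≈ (solve 3 (λ u e l → u :* con (+ 1) := u :* con (+ 1) :+ e :* (con (+ 0) :* l)) refl U ε (load i))))
      load≤ i (unselected k) _ = ≤-≈ (sym (by-relation (load i) (⁻¹-inverseʳ ε ε≉0)
        (solve 4 (λ u e e⁻¹ l → u :* con (+ 0) :+ e :* (e⁻¹ :* l) := l :+ l :* (e :* e⁻¹ :- con (+ 1)))
          refl U ε ℒ (load i))))
      load≤ i (extra k) eq = ≤-trans (within i) (≤-≈ (trans (*-congˡ (extra-closed i k eq))
        (solve 3 (λ u e l → u :* con (+ 0) := u :* con (+ 0) :+ e :* (con (+ 0) :* l)) refl U ε (load i))))
      sum-load : sum load ≈ M
      sum-load = trans (sum-comm (x p))
        (trans (sum-cong assigned) (trans (sum-const (#cli n)) (*-identityʳ M)))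
      sum-isSelected : sum (λ i → isSelected (kind b i)) ≈ N
      sum-isSelected = trans (sum-kind b isSelected)
        (trans (+-cong (+-cong (sum-const n) sum-0) sum-0)
               (solve 1 (λ N → N :* con (+ 1) :+ con (+ 0) :+ con (+ 0) := N) refl N))
      M≤ : M ≤ U * N + ε * sum C
      M≤ = ≤-resp-≈ sum-load
        (trans (sum-+ (λ i → U * isSelected (kind b i)) (λ i → ε * C i))
          (+-cong (trans (sym (*-sum U (λ i → isSelected (kind b i)))) (*-congˡ sum-isSelected))
                  (sym (*-sum ε C))))
        (sum-mono {f = load} (λ i → ≤-respʳ-≈ (+-congˡ (*-congˡ (sym (C≈ i)))) (load≤ i (kind b i) ≡.refl)))
      ε≤εC : ε ≤ ε * sum C
      ε≤εC = ≤-resp-≈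
        (trans (+-comm _ _) (trans (+-congˡ (-‿cong (*-comm U N))) capacity))
        (solve 2 (λ u c → :- u :+ (u :+ c) := c) refl (U * N) (ε * sum C))
        (+-monoʳ-≤ (- (U * N)) M≤)
      1≤C : 1# ≤ sum C
      1≤C = ≤-resp-≈
        (trans (*-comm _ _) (⁻¹-inverseʳ ε ε≉0))
        (by-relation (sum C) (⁻¹-inverseʳ ε ε≉0)
          (solve 3 (λ e e⁻¹ c → e⁻¹ :* (e :* c) := c :+ c :* (e :* e⁻¹ :- con (+ 1))) refl ε ℒ (sum C)))
        (*-monoˡ-≤ 0≤ℒ ε≤εC)

    -- The infimum is the supremum of the lower bounds: 1 is one of them, and the cost of a feasible
    -- vertex bounds them all.
    optimalCost : ∀ b → ∃[ v ] (OptimalCost (MixedIntegerFeasible n U) (objective b) v × 1# ≤ v)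
    optimalCost b = v ,
      ((λ p feasible → v-least _ (λ u u-lower → u-lower p feasible)) , v-upper) ,
      v-upper 1# (integral-cost≥1 b)
      where
      LowerBound : ℝ → Set
      LowerBound u = ∀ p → MixedIntegerFeasible n U p → u ≤ cost (objective b) p
      k₀ = Fin.fromℕ< 1≤n
      sup = complete LowerBound (1# , integral-cost≥1 b)
              (_ , λ u u-lower → u-lower (vertexWith b k₀) (vertexWith-feasible b k₀))
      v       = proj₁ sup
      v-upper = proj₁ (proj₂ sup)
      v-least = proj₂ (proj₂ sup)

    -- `w` is at most `N * δ`, hence `N * w ≤ 1# ≤ v`, and dividing by `w` gives the ratio.
    projection-gap : ∀ {S : Point n → Set} {B} b → S (projection b) → BoundsRatios n U S B → N ≤ B
    projection-gap b b∈S bounds with optimalCost b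
    ... | v , v-optimal , 1≤v
      with bounds (objective b) (objective-admissible b) v v-optimal
             (≤-trans 0≤1 1≤v , λ 0≈v → 1≤x⇒x≉0 1≤v (sym 0≈v))
    ... | w , w-optimal , (0≤w , 0≉w) , v/w≤B = ≤-trans
      (≤-respˡ-≈ cancel (*-monoˡ-≤ (⁻¹-nonNeg 0≤w w≉0) (≤-trans Nw≤1 1≤v)))
      (≤-respˡ-≈ (*-comm v (w ⁻¹)) v/w≤B)
      where
      w≉0 : ¬ w ≈ 0#
      w≉0 w≈0 = 0≉w (sym w≈0)
      Nw≤1 : N * w ≤ 1#
      Nw≤1 = ≤-trans
        (*-monoˡ-≤ 0≤N (≤-respʳ-≈ (projection-cost b) (proj₁ w-optimal _ b∈S)))
        (≤-gap (*-nonNeg 0≤N 0≤δ)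
          (sym (trans (solve 2 (λ N d → N :* (N :* d) :+ N :* d := d :* (N :+ N :* N)) refl N δ) δ[N+N²]≈1)))
      cancel : w ⁻¹ * (N * w) ≈ N
      cancel = by-relation N (⁻¹-inverseʳ w w≉0)
        (solve 3 (λ N w w⁻¹ → w⁻¹ :* (N :* w) := N :+ N :* (w :* w⁻¹ :- con (+ 1))) refl N w (w ⁻¹))

    -- Counting the constraints of a description.

    module _ {t} {D : Description n} (t<n : t ℕ.< n) (relaxation : IsRelaxation n U D) where

      relaxation-valid : ∀ p → MixedIntegerFeasible n U p → Polyhedron D p
      relaxation-valid p feasible = proj₁ relaxation p (feasible⇒hull p feasible)

      constraints-valid : All Valid D
      constraints-valid = All.tabulate (λ π∈D p feasible → All.lookup (relaxation-valid p feasible) π∈D)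

      -- Any constraint list describing D separates all 2ⁿ bit vectors.
      few-constraints⇒gap : ∀ D′ → (∀ p → Polyhedron D′ p ⇔ Polyhedron D p) →
        length D′ ℕ.< 2 ℕ.^ n → IntegralityGap≥ n U (SA t D) N
      few-constraints⇒gap D′ describes few B bounds with N ≤? B
      ... | yes N≤B = N≤B
      ... | no  N≰B = contradiction collision λ (i , j , i<j , eq) → Fin.<⇒≢ i<j (agree i j eq)
        where
        satisfied? : ∀ D b k → Dec (Polyhedron D (testPoint b k))
        satisfied? D b k = All.all? (λ π → affine π (testPoint b k) ≤? 0#) D
        -- If no test point of `b` were cut off, the projection for `b` would lie in `SA t D` and
        -- force `N ≤ B`.
        cut-off : ∀ b → ∃[ k ] ¬ Polyhedron D (testPoint b k)
        cut-off b = Fin.¬∀⟶∃¬ n _ (satisfied? D b) λ satisfied →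
          N≰B (projection-gap b (projection∈SA t<n constraints-valid b satisfied) bounds)
        violated : ∀ b → Any (λ π → ¬ affine π (testPoint b (proj₁ (cut-off b))) ≤ 0#) D′
        -- Being cut off is a property of the polyhedron, so every description, in particular `D′`,
        -- contains a violated constraint.
        violated b = ¬All⇒Any¬ (λ π → affine π (testPoint b (proj₁ (cut-off b))) ≤? 0#) D′
          (proj₂ (cut-off b) ∘ Equivalence.to (describes _))
        violator : Fin (2 ℕ.^ n) → Fin (length D′)
        violator i = Any.index (violated (bits n i))
        collision = Fin.pigeonhole few violator
        agree : ∀ i j → violator i ≡ violator j → i ≡ j
        -- Bit vectors sharing a violated constraint differ in no slot; decidable equality of bits
        -- turns this into agreement.
        agree i j eq = bits-injective n λ k₀ → decidable-stable (bits n i k₀ Bool.≟ bits n j k₀)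
          (violators-agree valid (bits n i) (bits n j) _ _
            (lookup-index (violated (bits n i)))
            (≡.subst (λ l → ¬ affine (List.lookup D′ l) (testPoint (bits n j) (proj₁ (cut-off (bits n j)))) ≤ 0#)
              (≡.sym eq) (lookup-index (violated (bits n j)))) k₀)
          where
          valid : Valid (List.lookup D′ (violator i))
          valid p feasible = All.lookup (Equivalence.from (describes p) (relaxation-valid p feasible))
            (∈-lookup (violator i))

  -- Choice of the parameters for large `n`.

  private
    ½ : ℝ
    ½ = fromℕ 2 ⁻¹

  2≉0 : ¬ fromℕ 2 ≈ 0#
  2≉0 = 1≤x⇒x≉0 (1≤fromℕ {2} (ℕ.s≤s ℕ.z≤n))

  2^k*½^k≈1 : ∀ k → fromℕ (2 ℕ.^ k) * ½ ^ k ≈ 1#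
  2^k*½^k≈1 zero    = trans (*-identityʳ _) (+-identityʳ 1#)
  2^k*½^k≈1 (suc k) = begin
    fromℕ (2 ℕ.* 2 ℕ.^ k) * (½ * ½ ^ k)
      ≈⟨ *-congʳ (fromℕ-* 2 (2 ℕ.^ k)) ⟩
    fromℕ 2 * fromℕ (2 ℕ.^ k) * (½ * ½ ^ k)
      ≈⟨ solve 4 (λ a b c d → a :* b :* (c :* d) := (a :* c) :* (b :* d)) refl (fromℕ 2) (fromℕ (2 ℕ.^ k)) ½ (½ ^ k) ⟩
    (fromℕ 2 * ½) * (fromℕ (2 ℕ.^ k) * ½ ^ k)
      ≈⟨ *-cong (⁻¹-inverseʳ (fromℕ 2) 2≉0) (2^k*½^k≈1 k) ⟩
    1# * 1#
      ≈⟨ *-identityˡ 1# ⟩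
    1# ∎

  0≤½^ : ∀ k → 0# ≤ ½ ^ k
  0≤½^ zero    = 0≤1
  0≤½^ (suc k) = *-nonNeg (⁻¹-nonNeg (fromℕ-nonNeg 2) 2≉0) (0≤½^ k)

  module _ (n : ℕ) (4≤n : 4 ℕ.≤ n) where

    private
      N : ℝ
      N = fromℕ n

    parameters : ∀ {U} → IsCapacity n U → Parameters n U
    parameters capacity = record
      { ε         = ½ ^ (n ℕ.* n)
      ; ν         = N ⁻¹
      ; τ         = (N * N + 1#) ⁻¹
      ; δ         = (N + N * N) ⁻¹
      ; 1≤n       = 1≤n
      ; 0≤ε       = 0≤½^ (n ℕ.* n)
      ; ε≉0       = λ ε≈0 → 0≉1 (trans (sym (trans (*-congˡ ε≈0) (zeroʳ _))) (2^k*½^k≈1 (n ℕ.* n)))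
      ; capacity  = capacity
      ; small     = ≤-resp-≈ (trans (*-comm _ _) (*-congʳ fromℕ-cubic))
                      (trans (*-comm _ _) (2^k*½^k≈1 (n ℕ.* n)))
                      (*-monoˡ-≤ (0≤½^ (n ℕ.* n)) (fromℕ-mono (cubic≤2^n² n 4≤n)))
      ; Nν≈1      = ⁻¹-inverseʳ N N≉0
      ; 0≤ν       = ⁻¹-nonNeg 0≤N N≉0
      ; τ[N²+1]≈1 = trans (*-comm _ _) (⁻¹-inverseʳ _ N²+1≉0)
      ; 0≤τ       = ⁻¹-nonNeg (+-nonNeg 0≤N² 0≤1) N²+1≉0
      ; δ[N+N²]≈1 = trans (*-comm _ _) (⁻¹-inverseʳ _ N+N²≉0)
      ; 0≤δ       = ⁻¹-nonNeg (+-nonNeg 0≤N 0≤N²) N+N²≉0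
      }
      where
      1≤n : 1 ℕ.≤ n
      1≤n = ℕ.≤-trans (ℕ.s≤s ℕ.z≤n) 4≤n
      0≤N : 0# ≤ N
      0≤N = fromℕ-nonNeg n
      0≤N² : 0# ≤ N * N
      0≤N² = 0≤x² N
      N≉0 : ¬ N ≈ 0#
      N≉0 = 1≤x⇒x≉0 (1≤fromℕ 1≤n)
      N²+1≉0 : ¬ N * N + 1# ≈ 0#
      N²+1≉0 = 1≤x⇒x≉0 (≤-gap 0≤N² (+-comm _ _))
      N+N²≉0 : ¬ N + N * N ≈ 0#
      N+N²≉0 = 1≤x⇒x≉0 (≤-trans (1≤fromℕ 1≤n) (x≤x+nonNeg 0≤N²))
      fromℕ-cubic : fromℕ (n ℕ.* n ℕ.* n ℕ.+ n ℕ.+ 1) ≈ N * N * N + N + 1#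
      fromℕ-cubic = begin
        fromℕ (n ℕ.* n ℕ.* n ℕ.+ n ℕ.+ 1)
          ≈⟨ trans (fromℕ-+ (n ℕ.* n ℕ.* n ℕ.+ n) 1) (+-congʳ (fromℕ-+ (n ℕ.* n ℕ.* n) n)) ⟩
        fromℕ (n ℕ.* n ℕ.* n) + N + fromℕ 1
          ≈⟨ +-cong (+-congʳ (trans (fromℕ-* (n ℕ.* n) n) (*-congʳ (fromℕ-* n n)))) (+-identityʳ 1#) ⟩
        N * N * N + N + 1# ∎

    -- Otherwise `N` would be at most its own half and hence at most 0, against `1# ≤ N`.
    half⇒< : ∀ {t} → fromℕ t ≤ ½ * N → t ℕ.< n
    half⇒< {t} t≤½n = ℕ.≰⇒> λ n≤t → 0≉1 (antisym 0≤1 (≤-trans (1≤fromℕ (ℕ.≤-trans (ℕ.s≤s ℕ.z≤n) 4≤n))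
      (N≤0 (≤-trans (fromℕ-mono n≤t) t≤½n))))
      where
      N≤0 : N ≤ ½ * N → N ≤ 0#
      N≤0 N≤½N = ≤-resp-≈
        (solve 1 (λ N → (con (+ 1) :+ (con (+ 1) :+ con (+ 0))) :* N :- N := N) refl N)
        (by-relation N (⁻¹-inverseʳ (fromℕ 2) 2≉0)
          (solve 3 (λ N d h → d :* (h :* N) :- N := con (+ 0) :+ N :* (d :* h :- con (+ 1))) refl N (fromℕ 2) ½))
        (≤-resp-≈ (+-comm _ _) (+-comm _ _) (+-monoʳ-≤ (- N) (*-monoˡ-≤ (fromℕ-nonNeg 2) N≤½N)))

theorem5p2 : (𝓡 : RealNumbers) →
    let open RealNumbers 𝓡
        open CFL 𝓡
    in
    (U : ℕ → Carrier) →
    (∀ n → 1 ℕ.≤ n → IsCapacity n (U n)) →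
    (P : (n : ℕ) → Description n) →
    (∀ n → 1 ℕ.≤ n → IsRelaxation n (U n) (P n)) →
    (size : ℕ → ℕ) →
    (∀ n → 1 ℕ.≤ n → HasSize (P n) (size n)) →
    SubExponential size →
    ∃[ c ] (0# < c ×
      (∃[ K ] (0# < K ×
        (∃[ n₀ ] (∀ n → n₀ ℕ.≤ n → 1 ℕ.≤ n →
          ∀ t → 1 ℕ.≤ t → fromℕ t ≤ c * fromℕ n →
          IntegralityGap≥ n (U n) (SA t (P n)) (K * fromℕ n))))))
theorem5p2 𝓡 U capacity P relaxation size hasSize subexponential =
  -- The constant `c` is one half, which keeps `t` below `n` so that some extra facility escapes
  -- `W`; `K` is 1.
  fromℕ 2 ⁻¹ , (⁻¹-nonNeg (fromℕ-nonNeg 2) 2≉0 , λ 0≈½ → ⁻¹-nonZero 2≉0 (sym 0≈½)) ,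
  1# , (0≤1 , 0≉1) ,
  -- From `n₁` on, `size n ^ 2 ≤ 2 ^ n`, so fewer than `2 ^ n` constraints are available; the 4
  -- serves `cubic≤2^n²`.
  n₁ ℕ.+ 4 , gap
  where
  open RealNumbers 𝓡
  open CFL 𝓡
  open Reals 𝓡
  open Construction 𝓡
  n₁ : ℕ
  n₁ = proj₁ (subexponential 2)
  gap : ∀ n → n₁ ℕ.+ 4 ℕ.≤ n → 1 ℕ.≤ n → ∀ t → 1 ℕ.≤ t → fromℕ t ≤ fromℕ 2 ⁻¹ * fromℕ n →
        IntegralityGap≥ n (U n) (SA t (P n)) (1# * fromℕ n)
  gap n n₀≤n 1≤n t _ t≤½n B bounds with hasSize n 1≤n
  ... | (D′ , describes , ∣D′∣≡size) , _ = ≤-respˡ-≈ (sym (*-identityˡ _))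
    (Instance.few-constraints⇒gap (parameters n 4≤n (capacity n 1≤n)) (half⇒< n 4≤n t≤½n)
      (relaxation n 1≤n) D′ describes
      (≡.subst (ℕ._< 2 ℕ.^ n) (≡.sym ∣D′∣≡size)
        (s²≤2^n⇒s<2^n 1≤n (proj₂ (subexponential 2) n (ℕ.≤-trans (ℕ.m≤m+n n₁ 4) n₀≤n))))
      B bounds)
    where
    4≤n : 4 ℕ.≤ n
    4≤n = ℕ.≤-trans (ℕ.m≤n+m 4 n₁) n₀≤n
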